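{- Let $k$ and $\ell$ be coprime positive integers with $k$ odd, and write $q:=2^k$ and $Q:=2^\ell$. Write $R(X,Y):=(X+\alpha Y)^{Q+1}+(\beta Y)^{Q+1}$ with $\alpha,\beta\in\mathbb{F}_q^*$. Then the function $\psi\colon(x,y)\mapsto\bigl(R(x,y),R(y,x)\bigr)$ induces a permutation of $\mathbb{F}_q\times\mathbb{F}_q$ if and only if $\alpha^2+\alpha\beta+\beta^2=1$. -}

module Defs where

open import Level using (Level; suc; _⊔_)
open import Algebra.Bundles using (CommutativeRing)
open import Data.Fin.Base using (Fin)
open import Data.Nat.Base as ℕ using (ℕ)
open import Data.Product.Base using (_×_; _,_)
open import Data.Product.Relation.Binary.Pointwise.NonDependent using (Pointwise)
open import Function.Bundles using (Inverse)
open import Function.Definitions using (Bijective)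
import Algebra.Definitions
import Algebra.Properties.Semiring.Exp
import Relation.Binary.PropositionalEquality as ≡

-- A field with exactly q elements up to _≈_.  The enumeration makes _≈_
-- decidable, so, unlike for HeytingField, no separate apartness relation is
-- needed: "nonzero" is the negation of x ≈ 0#.  A field of prime-power order
-- is unique up to isomorphism, so statements about 𝔽_q quantify over all
-- fields of this kind.
record FiniteField (q : ℕ) (c r : Level) : Set (suc (c ⊔ r)) where
  field
    commutativeRing : CommutativeRing c r

  open CommutativeRing commutativeRing public
  open Algebra.Definitions _≈_ public
    using (Invertible)
  open Algebra.Properties.Semiring.Exp semiring public
    using (_^_)

  field
    0≉1         : 0# ≉ 1#
    invertible  : ∀ {x} → x ≉ 0# → Invertible 1# _*_ x
    enumeration : Inverse setoid (≡.setoid (Fin q))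

module _ {q : ℕ} {c r : Level} (F : FiniteField q c r) where
  open FiniteField F

  IsPermutation² : (Carrier × Carrier → Carrier × Carrier) → Set (c ⊔ r)
  IsPermutation² = Bijective (Pointwise _≈_ _≈_) (Pointwise _≈_ _≈_)

  R : (Q : ℕ) (α β : Carrier) → Carrier → Carrier → Carrier
  R Q α β x y = (x + α * y) ^ (Q ℕ.+ 1) + (β * y) ^ (Q ℕ.+ 1)

  ψ : (Q : ℕ) (α β : Carrier) → Carrier × Carrier → Carrier × Carrier
  ψ Q α β (x , y) = R Q α β x y , R Q α β y x

{-# OPTIONS --safe #-}

-- Write σ x = x ^ Q and N x = x σ(x).  Since k is odd and coprime to ℓ, the
-- fixed field of σ is 𝔽₂, N is injective and σ z = z + 1 has no solution.
--
-- If α² + αβ + β² = 1, then in the coordinates X = x + αy, Y = βy both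
-- components of ψ are combinations of the two components of u ↦ u σ(u) on
-- 𝔽_q(ω), where u = X + Yω, ω² = ω + 1 and σ is extended by σ(ω) = ω.  If u
-- and u′ have the same image, then u/u′ = t₀ + t₁ω has t σ(t) = 1; its
-- ω-component makes t₀/t₁ a solution of σ z = z + 1 unless t₁ = 0.
--
-- Conversely, if ψ permutes 𝔽_q², then the sum of s⁻¹t over s = R(x,y),
-- t = R(y,x) equals the sum over all pairs (s,t), which is 0 (with 0⁻¹ = 0).
-- In the coordinates X, Y we have R(x,y) = N X + N Y, and
-- R(y,x) = e N X + f X σ(Y) + g Y σ(X) + h N Y, and the sum comes out as
-- f + g, because it reduces to ∑ x / (N x + 1) = ∑ Tr(s) / s = 1.  Now f = g
-- says that (α² + β² + 1) / αβ is fixed by σ, hence is 0 or 1; it is not 0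
-- because ψ(1,1) ≠ ψ(0,0).
module Submission where

open import Defs
open import Data.Nat.Base as ℕ using (ℕ; _<_; zero; suc)
open import Data.Nat.Coprimality using (Coprime; coprime-Bézout)
open import Data.Nat.Divisibility using (_∤_; divides)
open import Function.Bundles using (_⇔_; mk⇔; Inverse; mk↔ₛ′)
open import Level using (Level; _⊔_)

open import Algebra.Bundles using (CommutativeMonoid; RawRing)
open import Algebra.Solver.Ring.AlmostCommutativeRing
  using (fromCommutativeRing; _-Raw-AlmostCommutative⟶_; Induced-equivalence)
open import Data.Bool.Base using (Bool; true; false; _xor_; _∧_)
open import Data.Fin.Base as Fin
  using (Fin; zero; suc; _↑ˡ_; _↑ʳ_; combine; remQuot; punchIn; punchOut)
open import Data.Fin.Permutation using (Permutation)
open import Data.Maybe.Base using (just; nothing)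
open import Data.Nat.GCD using (module Bézout)
open import Data.Nat.GeneralisedArithmetic using (fold)
open import Data.Nat.Induction using (<-rec)
open import Data.Nat.Solver using (module +-*-Solver)
open import Data.Product.Base using (_×_; _,_; proj₁; proj₂; ∃; swap)
open import Data.Product.Relation.Binary.Pointwise.NonDependent using (Pointwise; ×-setoid)
open import Data.Sum.Base using (_⊎_; inj₁; inj₂; [_,_]′)
open import Function.Base using (_∘_; id)
open import Function.Definitions using (Congruent; Injective)
open import Relation.Binary.Bundles using (Setoid)
open import Relation.Binary.Definitions using (WeaklyDecidable)
open import Relation.Binary.PropositionalEquality as ≡ using (_≡_; module ≡-Reasoning)
open import Relation.Nullary.Decidable using (Dec; yes; no; map′)
open import Relation.Nullary.Negation using (¬_; contradiction)
import Algebra.Properties.CommutativeMonoid.Sum as Sum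
import Algebra.Properties.CommutativeSemiring.Exp as CommutativeExp
import Algebra.Properties.Group as GroupProperties
import Algebra.Properties.Semiring.Mult as Mult
import Algebra.Properties.Semiring.Sum as SemiringSum
import Algebra.Solver.Ring as RingSolver
import Data.Fin.Properties as Fin
import Data.Nat.Properties as ℕ
import Relation.Binary.Reasoning.Setoid as SetoidReasoning

-- Sums over finite setoids

-- If `j` were missed, punching it out of the codomain would inject `Fin (suc n)` into `Fin n`.
Fin-injective⇒surjective : ∀ {n} (f : Fin n → Fin n) → Injective _≡_ _≡_ f → ∀ j → ∃ λ i → f i ≡ j
Fin-injective⇒surjective {suc n} f f-inj j with Fin.any? (λ i → f i Fin.≟ j)
... | yes hit = hit
... | no miss = contradiction (Fin.injective⇒≤ g-inj) ℕ.1+n≰n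
  where
  j≢f : ∀ i → ¬ j ≡ f i
  j≢f i j≡fi = miss (i , ≡.sym j≡fi)
  g : Fin (suc n) → Fin n
  g i = punchOut (j≢f i)
  g-inj : Injective _≡_ _≡_ g
  g-inj {i} {i′} eq = f-inj (Fin.punchOut-injective (j≢f i) (j≢f i′) eq)

module Finite {a r} (S : Setoid a r) {n : ℕ} (enum : Inverse S (≡.setoid (Fin n))) where
  open Setoid S
  open Inverse enum using (to; from; to-cong; strictlyInverseˡ; strictlyInverseʳ)

  to-injective : ∀ {x y} → to x ≡ to y → x ≈ y
  to-injective {x} {y} eq = trans (sym (strictlyInverseʳ x))
    (trans (reflexive (≡.cong from eq)) (strictlyInverseʳ y))

  from-injective : ∀ {i j} → from i ≈ from j → i ≡ j
  from-injective {i} {j} eq =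
    ≡.trans (≡.sym (strictlyInverseˡ i)) (≡.trans (to-cong eq) (strictlyInverseˡ j))

  infix 4 _≟_
  _≟_ : ∀ x y → Dec (x ≈ y)
  x ≟ y = map′ to-injective to-cong (to x Fin.≟ to y)

  all? : ∀ {p} {P : Carrier → Set p} → (∀ {x y} → x ≈ y → P x → P y) →
         (∀ x → Dec (P x)) → Dec (∀ x → P x)
  all? resp P? = map′ (λ ∀P x → resp (strictlyInverseʳ x) (∀P (to x))) (λ ∀P i → ∀P (from i))
                      (Fin.all? (λ i → P? (from i)))

  module _ {g : Carrier → Carrier} (g-cong : Congruent _≈_ _≈_ g) (g-inj : Injective _≈_ _≈_ g) where

    private
      h : Fin n → Fin n
      h i = to (g (from i))

      h-inj : Injective _≡_ _≡_ h
      h-inj eq = from-injective (g-inj (to-injective eq))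

      h⁻¹ : ∀ j → ∃ λ i → h i ≡ j
      h⁻¹ = Fin-injective⇒surjective h h-inj

    permutation : Permutation n n
    permutation = mk↔ₛ′ h (proj₁ ∘ h⁻¹) (proj₂ ∘ h⁻¹) (λ i → h-inj (proj₂ (h⁻¹ (h i))))

    -- The quantifier over `z` is the shape in which `Bijective` asks for surjectivity over a
    -- setoid.
    injective⇒surjective : ∀ y → ∃ λ x → ∀ {z} → z ≈ x → g z ≈ y
    injective⇒surjective y with h⁻¹ (to y)
    ... | i , eq = from i , λ z≈x → trans (g-cong z≈x) (to-injective eq)

  -- Any commutative monoid is allowed: the additive one gives sums, the multiplicative one the
  -- product in `x^order≈x`.
  module Summation {b s} (M : CommutativeMonoid b s) where
    private module M = CommutativeMonoid M

    open Sum M using (sum; sum-cong-≋; sum-permute; sum-remove; sum-replicate-zero; ∑-distrib-+)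

    ∑ : (Carrier → M.Carrier) → M.Carrier
    ∑ f = sum (f ∘ from)

    ∑-cong : ∀ {f g} → (∀ x → f x M.≈ g x) → ∑ f M.≈ ∑ g
    ∑-cong f≈g = sum-cong-≋ (λ i → f≈g (from i))

    ∑-ε : ∀ {f} → (∀ x → f x M.≈ M.ε) → ∑ f M.≈ M.ε
    ∑-ε f≈ε = M.trans (∑-cong f≈ε) (sum-replicate-zero n)

    ∑-∙ : ∀ f g → ∑ (λ x → f x M.∙ g x) M.≈ ∑ f M.∙ ∑ g
    ∑-∙ f g = ∑-distrib-+ (f ∘ from) (g ∘ from)

    -- Injectivity of `g` suffices, since an injective self-map of a finite setoid is a permutation.
    ∑-reindex : ∀ {f} (g : Carrier → Carrier) → Congruent _≈_ M._≈_ f →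
                Congruent _≈_ _≈_ g → Injective _≈_ _≈_ g → ∑ f M.≈ ∑ (f ∘ g)
    ∑-reindex g f-cong g-cong g-inj =
      M.trans (sum-permute _ (permutation g-cong g-inj))
              (sum-cong-≋ (λ i → f-cong (strictlyInverseʳ (g (from i)))))

    sum-single : ∀ {m} (f : Fin m → M.Carrier) i → (∀ j → ¬ j ≡ i → f j M.≈ M.ε) → sum f M.≈ f i
    sum-single {suc m} f i f≈ε = M.trans (sum-remove {i = i} f)
      (M.trans (M.∙-congˡ (M.trans (sum-cong-≋ (λ j → f≈ε (punchIn i j) (Fin.punchInᵢ≢i i j)))
                                   (sum-replicate-zero m)))
               (M.identityʳ (f i)))

    ∑-single : ∀ {f} x₀ → Congruent _≈_ M._≈_ f → (∀ x → ¬ x ≈ x₀ → f x M.≈ M.ε) → ∑ f M.≈ f x₀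
    ∑-single x₀ f-cong f≈ε = M.trans
      (sum-single _ (to x₀) λ j j≢x₀ → f≈ε (from j)
        (λ eq → j≢x₀ (≡.trans (≡.sym (strictlyInverseˡ j)) (to-cong eq))))
      (f-cong (strictlyInverseʳ x₀))

module _ {b s} (M : CommutativeMonoid b s) where
  open CommutativeMonoid M
  open Sum M using (sum; sum-cong-≋)

  sum-++ : ∀ m {n} (f : Fin (m ℕ.+ n) → Carrier) →
           sum f ≈ sum (λ i → f (i ↑ˡ n)) ∙ sum (λ j → f (m ↑ʳ j))
  sum-++ zero    f = sym (identityˡ _)
  sum-++ (suc m) f = trans (∙-congˡ (sum-++ m (f ∘ suc))) (sym (assoc _ _ _))

  sum-combine : ∀ m {n} (f : Fin (m ℕ.* n) → Carrier) →
                sum f ≈ sum (λ i → sum (λ j → f (combine {m} {n} i j)))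
  sum-combine zero        f = refl
  sum-combine (suc m) {n} f = trans (sum-++ n f) (∙-congˡ (sum-combine m (f ∘ (n ↑ʳ_))))

module Square {a r} (S : Setoid a r) {n : ℕ} (enum : Inverse S (≡.setoid (Fin n))) where
  private
    module S = Setoid S
    module E = Inverse enum

  -- Makes the pairs a finite setoid too, so that sums over pairs, their reindexing and the
  -- surjectivity of an injective `ψ` are all instances of `Finite`.
  enum² : Inverse (×-setoid S S) (≡.setoid (Fin (n ℕ.* n)))
  enum² = record
    { to        = to
    ; from      = from
    ; to-cong   = to-cong
    ; from-cong = λ { ≡.refl → S.refl , S.refl }
    ; inverse   = (λ {i} eq → ≡.trans (to-cong eq) (to-from i))
                , (λ { {p} ≡.refl → from-to p })
    }
    where
    to : S.Carrier × S.Carrier → Fin (n ℕ.* n)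
    to (x , y) = combine (E.to x) (E.to y)
    from : Fin (n ℕ.* n) → S.Carrier × S.Carrier
    from i = E.from (proj₁ (remQuot {n} n i)) , E.from (proj₂ (remQuot {n} n i))
    to-cong : Congruent (Pointwise S._≈_ S._≈_) _≡_ to
    to-cong (p , q) = ≡.cong₂ combine (E.to-cong p) (E.to-cong q)
    to-from : ∀ i → to (from i) ≡ i
    to-from i = ≡.trans (≡.cong₂ combine (E.strictlyInverseˡ _) (E.strictlyInverseˡ _))
                        (Fin.combine-remQuot {n} n i)
    from-to : ∀ p → Pointwise S._≈_ S._≈_ (from (to p)) p
    from-to (x , y) = ≡.subst (λ p → Pointwise S._≈_ S._≈_ (E.from (proj₁ p) , E.from (proj₂ p)) (x , y))
      (≡.sym (Fin.remQuot-combine {n} {n} (E.to x) (E.to y)))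
      (E.strictlyInverseʳ x , E.strictlyInverseʳ y)

  module Summation² {b s} (M : CommutativeMonoid b s) where
    open CommutativeMonoid M
    open Sum M using (sum-cong-≋)
    open Finite.Summation S enum M using (∑)
    open Finite.Summation (×-setoid S S) enum² M public
      using () renaming (∑ to ∑²; ∑-cong to ∑²-cong; ∑-∙ to ∑²-∙; ∑-reindex to ∑²-reindex)

    ∑²-iterated : ∀ f → ∑² f ≈ ∑ (λ x → ∑ (λ y → f (x , y)))
    ∑²-iterated f = trans (sum-combine M n _) (sum-cong-≋ λ i → sum-cong-≋ λ j →
      reflexive (≡.cong (λ p → f (E.from (proj₁ p) , E.from (proj₂ p)))
                        (Fin.remQuot-combine {n} {n} i j)))

-- Finite fields

module FieldTheory {q : ℕ} {c r : Level} (F : FiniteField q c r) where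
  open FiniteField F public
  open SetoidReasoning setoid
  open Finite setoid enumeration public using (_≟_; all?; module Summation)
  open Square setoid enumeration public using (enum²; module Summation²)
  open CommutativeExp commutativeSemiring public using (^-homo-*; ^-assocʳ; ^-distrib-*; ^-congˡ; ^-congʳ)
  open Mult semiring using (×1-homo-*) renaming (_×_ to _·_)

  Op₁ : Set c
  Op₁ = Carrier → Carrier

  -- The value `0#` at zero makes `inv` an involution of the whole field, along which sums can be
  -- reindexed, and keeps it multiplicative without exceptions.
  inv : Op₁
  inv x with x ≟ 0#
  ... | yes _ = 0#
  ... | no x≉0 = proj₁ (invertible x≉0)

  inverseʳ : ∀ {x} → x ≉ 0# → x * inv x ≈ 1#
  inverseʳ {x} x≉0 with x ≟ 0#
  ... | yes x≈0 = contradiction x≈0 x≉0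
  ... | no x≉0′ = proj₂ (proj₂ (invertible x≉0′))

  inv-zero : ∀ {x} → x ≈ 0# → inv x ≈ 0#
  inv-zero {x} x≈0 with x ≟ 0#
  ... | yes _ = refl
  ... | no x≉0 = contradiction x≈0 x≉0

  *-cancelˡ-nonZero : ∀ {x y z} → x ≉ 0# → x * y ≈ x * z → y ≈ z
  *-cancelˡ-nonZero {x} {y} {z} x≉0 xy≈xz = begin
    y                 ≈⟨ *-identityˡ y ⟨
    1# * y            ≈⟨ *-congʳ x⁻¹x≈1 ⟨
    inv x * x * y     ≈⟨ *-assoc _ _ _ ⟩
    inv x * (x * y)   ≈⟨ *-congˡ xy≈xz ⟩
    inv x * (x * z)   ≈⟨ *-assoc _ _ _ ⟨
    inv x * x * z     ≈⟨ *-congʳ x⁻¹x≈1 ⟩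
    1# * z            ≈⟨ *-identityˡ z ⟩
    z                 ∎
    where
    x⁻¹x≈1 : inv x * x ≈ 1#
    x⁻¹x≈1 = trans (*-comm _ _) (inverseʳ x≉0)

  *≈0⇒≈0 : ∀ {x y} → x ≉ 0# → x * y ≈ 0# → y ≈ 0#
  *≈0⇒≈0 {x} x≉0 xy≈0 = *-cancelˡ-nonZero x≉0 (trans xy≈0 (sym (zeroʳ x)))

  *-nonZero : ∀ {x y} → x ≉ 0# → y ≉ 0# → x * y ≉ 0#
  *-nonZero x≉0 y≉0 xy≈0 = y≉0 (*≈0⇒≈0 x≉0 xy≈0)

  *≈1⇒≉0 : ∀ {x y} → x * y ≈ 1# → x ≉ 0#
  *≈1⇒≉0 xy≈1 x≈0 = 0≉1 (trans (sym (zeroˡ _)) (trans (*-congʳ (sym x≈0)) xy≈1))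

  inv-unique : ∀ {x y} → x * y ≈ 1# → inv x ≈ y
  inv-unique xy≈1 = *-cancelˡ-nonZero x≉0 (trans (inverseʳ x≉0) (sym xy≈1))
    where x≉0 = *≈1⇒≉0 xy≈1

  inv-cong : Congruent _≈_ _≈_ inv
  inv-cong {x} {y} x≈y with y ≟ 0#
  ... | yes y≈0 = inv-zero (trans x≈y y≈0)
  ... | no y≉0 = inv-unique (trans (*-congʳ x≈y) (proj₂ (proj₂ (invertible y≉0))))

  inv-involutive : ∀ x → inv (inv x) ≈ x
  inv-involutive x with x ≟ 0#
  ... | yes x≈0 = trans (inv-zero refl) (sym x≈0)
  ... | no x≉0 = inv-unique (proj₁ (proj₂ (invertible x≉0)))

  inv-injective : Injective _≈_ _≈_ inv
  inv-injective {x} {y} eq = trans (sym (inv-involutive x)) (trans (inv-cong eq) (inv-involutive y))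

  open Summation +-commutativeMonoid public
  open Summation² +-commutativeMonoid public

  +-cancelʳ : ∀ {x y} z → x + z ≈ y + z → x ≈ y
  +-cancelʳ z = GroupProperties.∙-cancelʳ +-group z _ _

  ∑-*ˡ : ∀ a f → ∑ (λ x → a * f x) ≈ a * ∑ f
  ∑-*ˡ a f = sym (SemiringSum.*-distribˡ-sum semiring a (f ∘ Inverse.from enumeration))

  ∑²-*ˡ : ∀ a f → ∑² (λ p → a * f p) ≈ a * ∑² f
  ∑²-*ˡ a f = sym (SemiringSum.*-distribˡ-sum semiring a (f ∘ Inverse.from enum²))

  -- Translation by `1#` permutes the field, so adding `1#` to every term of `∑ id` does not change
  -- it.
  ∑1≈0 : ∑ (λ _ → 1#) ≈ 0#
  ∑1≈0 = +-cancelʳ (∑ id) (begin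
    ∑ (λ _ → 1#) + ∑ id    ≈⟨ ∑-∙ (λ _ → 1#) id ⟨
    ∑ (1# +_)              ≈⟨ ∑-reindex (1# +_) id +-congˡ (GroupProperties.∙-cancelˡ +-group 1# _ _) ⟨
    ∑ id                   ≈⟨ +-identityˡ _ ⟨
    0# + ∑ id              ∎)

  order·1≈0 : q · 1# ≈ 0#
  order·1≈0 = trans (sym (Sum.sum-replicate +-commutativeMonoid q)) ∑1≈0

  -- Multiplication by a nonzero `a` permutes the field and so preserves the product `P` of the
  -- nonzero elements. To let products run over all elements, `g` replaces zero by `1#`, and `h`
  -- carries the surplus factor `a` that this creates at zero.
  x^order≈x : ∀ x → x ^ q ≈ x
  x^order≈x a with a ≟ 0#
  ... | yes a≈0 = trans (^-congˡ q a≈0) (trans (0^order (Inverse.to enumeration 0#)) (sym a≈0))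
    where
    -- An inhabitant of `Fin n`, here the index of `0#`, rules out `n = 0`, where the power would be
    -- `1#`.
    0^order : ∀ {n} → Fin n → 0# ^ n ≈ 0#
    0^order {suc n} _ = zeroˡ _
  ... | no a≉0 = *-cancelˡ-nonZero P≉0 (begin
    P * a ^ q                                        ≈⟨ *-comm _ _ ⟩
    a ^ q * P                                        ≈⟨ *-congʳ (Sum.sum-replicate *-commutativeMonoid q) ⟨
    ∏ (λ _ → a) * P                                  ≈⟨ ∏-∙ (λ _ → a) g ⟨
    ∏ (λ x → a * g x)                                ≈⟨ ∏-cong a*g ⟩
    ∏ (λ x → g (a * x) * h x)                        ≈⟨ ∏-∙ (λ x → g (a * x)) h ⟩
    ∏ (λ x → g (a * x)) * ∏ h
      ≈⟨ *-cong (sym (∏-reindex (a *_) g-cong *-congˡ (*-cancelˡ-nonZero a≉0)))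
                                                               (∏-single 0# h-cong h≈1) ⟩
    P * h 0#                                         ≈⟨ *-congˡ h0 ⟩
    P * a                                            ∎)
    where
    open Summation *-commutativeMonoid using ()
      renaming (∑ to ∏; ∑-cong to ∏-cong; ∑-∙ to ∏-∙; ∑-reindex to ∏-reindex; ∑-single to ∏-single)
    g h : Op₁
    g x with x ≟ 0#
    ... | yes _ = 1#
    ... | no _  = x
    h x with x ≟ 0#
    ... | yes _ = a
    ... | no _  = 1#
    P : Carrier
    P = ∏ g
    g≉0 : ∀ x → g x ≉ 0#
    g≉0 x with x ≟ 0#
    ... | yes _   = 0≉1 ∘ sym
    ... | no x≉0 = x≉0
    product≉0 : ∀ {n} (v : Fin n → Carrier) → (∀ i → v i ≉ 0#) → Sum.sum *-commutativeMonoid v ≉ 0#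
    product≉0 {zero}  v v≉0 = 0≉1 ∘ sym
    product≉0 {suc n} v v≉0 = *-nonZero (v≉0 _) (product≉0 (v ∘ Fin.suc) (v≉0 ∘ Fin.suc))
    P≉0 : P ≉ 0#
    P≉0 = product≉0 (g ∘ Inverse.from enumeration) (g≉0 ∘ Inverse.from enumeration)
    g-cong : Congruent _≈_ _≈_ g
    g-cong {x} {y} x≈y with x ≟ 0# | y ≟ 0#
    ... | yes _   | yes _   = refl
    ... | no _    | no _    = x≈y
    ... | yes x≈0 | no y≉0  = contradiction (trans (sym x≈y) x≈0) y≉0
    ... | no x≉0  | yes y≈0 = contradiction (trans x≈y y≈0) x≉0
    h0 : h 0# ≈ a
    h0 with 0# ≟ 0#
    ... | yes _ = refl
    ... | no 0≉0 = contradiction refl 0≉0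
    h≈1 : ∀ x → x ≉ 0# → h x ≈ 1#
    h≈1 x x≉0 with x ≟ 0#
    ... | yes x≈0 = contradiction x≈0 x≉0
    ... | no _    = refl
    h-cong : Congruent _≈_ _≈_ h
    h-cong {x} {y} x≈y with x ≟ 0# | y ≟ 0#
    ... | yes _   | yes _   = refl
    ... | no _    | no _    = refl
    ... | yes x≈0 | no y≉0  = contradiction (trans (sym x≈y) x≈0) y≉0
    ... | no x≉0  | yes y≈0 = contradiction (trans x≈y y≈0) x≉0
    a*g : ∀ x → a * g x ≈ g (a * x) * h x
    a*g x with x ≟ 0# | (a * x) ≟ 0#
    ... | yes _   | yes _    = *-comm _ _
    ... | no _    | no _     = sym (*-identityʳ _)
    ... | yes x≈0 | no ax≉0  = contradiction (trans (*-congˡ x≈0) (zeroʳ a)) ax≉0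
    ... | no x≉0  | yes ax≈0 = contradiction ax≈0 (*-nonZero a≉0 x≉0)

  module CharacteristicTwo (1+1≈0 : 1# + 1# ≈ 0#) where

    x+x≈0 : ∀ x → x + x ≈ 0#
    x+x≈0 x = begin
      x + x             ≈⟨ +-cong (*-identityʳ x) (*-identityʳ x) ⟨
      x * 1# + x * 1#   ≈⟨ distribˡ x 1# 1# ⟨
      x * (1# + 1#)     ≈⟨ *-congˡ 1+1≈0 ⟩
      x * 0#            ≈⟨ zeroʳ x ⟩
      0#                ∎

    x+y≈0⇒x≈y : ∀ {x y} → x + y ≈ 0# → x ≈ y
    x+y≈0⇒x≈y {x} {y} eq = +-cancelʳ y (trans eq (sym (x+x≈0 y)))

    private
      -‿id : ∀ x → x ≈ - x
      -‿id x = x+y≈0⇒x≈y (-‿inverseʳ x)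

      -- With coefficients in 𝔽₂ the ring solver cancels equal terms, so it proves identities that
      -- hold only in characteristic two.
      𝔽₂ : RawRing _ _
      𝔽₂ = record { Carrier = Bool ; _≈_ = _≡_ ; _+_ = _xor_ ; _*_ = _∧_ ; -_ = id ; 0# = false ; 1# = true }

      ⟦_⟧₂ : Bool → Carrier
      ⟦ false ⟧₂ = 0#
      ⟦ true ⟧₂ = 1#

      embed : 𝔽₂ -Raw-AlmostCommutative⟶ fromCommutativeRing commutativeRing
      embed = record
        { ⟦_⟧    = ⟦_⟧₂
        ; +-homo = λ { false y → sym (+-identityˡ _) ; true false → sym (+-identityʳ _) ; true true → sym 1+1≈0 }
        ; *-homo = λ { false y → sym (zeroˡ _) ; true y → sym (*-identityˡ _) }
        ; -‿homo = λ x → -‿id _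
        ; 0-homo = refl
        ; 1-homo = refl
        }

      _≟₂_ : WeaklyDecidable (Induced-equivalence embed)
      false ≟₂ false = just refl
      true  ≟₂ true  = just refl
      _     ≟₂ _     = nothing

    open RingSolver 𝔽₂ (fromCommutativeRing commutativeRing) embed _≟₂_ public
      using (solve; _:=_; _:+_; _:*_; con; Polynomial)

    :0 :1 : ∀ {n} → Polynomial n
    :0 = con false
    :1 = con true

    square-additive : ∀ x y → (x + y) * (x + y) ≈ x * x + y * y
    square-additive = solve 2 (λ x y → (x :+ y) :* (x :+ y) := x :* x :+ y :* y) refl

-- Sufficiency

-- What both directions use of `x ↦ x ^ Q`: a ring endomorphism of odd order with fixed field 𝔽₂.
record OddAutomorphism {q : ℕ} {c r : Level} (F : FiniteField q c r) : Set (c ⊔ r) where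
  open FiniteField F
  field
    1+1≈0     : 1# + 1# ≈ 0#
    σ         : Carrier → Carrier
    σ-cong    : Congruent _≈_ _≈_ σ
    σ-+       : ∀ x y → σ (x + y) ≈ σ x + σ y
    σ-*       : ∀ x y → σ (x * y) ≈ σ x * σ y
    σ-1       : σ 1# ≈ 1#
    fixed     : ∀ {x} → σ x ≈ x → x ≈ 0# ⊎ x ≈ 1#
    -- 1 + 2 half is the least odd d with σᵈ = id.  It is in fact k, but
    -- minimality is all that is used, and it needs no count of roots.
    half      : ℕ
    odd-order : ∀ x → fold x σ (suc (half ℕ.+ half)) ≈ x
    minimal   : ∀ {i} → i < half → ¬ (∀ x → fold x σ (suc (i ℕ.+ i)) ≈ x)

module Norm {q : ℕ} {c r : Level} {F : FiniteField q c r} (Φ : OddAutomorphism F) where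
  open FieldTheory F public
  open OddAutomorphism Φ public
  open CharacteristicTwo 1+1≈0 public
  open SetoidReasoning setoid

  σ-0 : σ 0# ≈ 0#
  σ-0 = begin
    σ 0#           ≈⟨ σ-cong (+-identityˡ 0#) ⟨
    σ (0# + 0#)    ≈⟨ σ-+ 0# 0# ⟩
    σ 0# + σ 0#    ≈⟨ x+x≈0 (σ 0#) ⟩
    0#             ∎

  -- If σ² fixes `x`, so does its power with exponent `half`; one more σ completes the odd order.
  σσ-fixed⇒σ-fixed : ∀ {x} → σ (σ x) ≈ x → σ x ≈ x
  σσ-fixed⇒σ-fixed {x} σσx≈x = trans (σ-cong (sym (even half))) (odd-order x)
    where
    even : ∀ n → fold x σ (n ℕ.+ n) ≈ x
    even zero = refl
    even (suc n) rewrite ℕ.+-suc n n = trans (σ-cong (σ-cong (even n))) σσx≈x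

  -- Such an `x` would be fixed by σ², since the two ones cancel, hence by σ, which forces
  -- `1# ≈ 0#`.
  σx≉1+x : ∀ {x} → σ x ≉ 1# + x
  σx≉1+x {x} σx≈1+x = 0≉1 (sym (+-cancelʳ x (begin
    1# + x     ≈⟨ σx≈1+x ⟨
    σ x        ≈⟨ σσ-fixed⇒σ-fixed σσx≈x ⟩
    x          ≈⟨ +-identityˡ x ⟨
    0# + x     ∎)))
    where
    σσx≈x : σ (σ x) ≈ x
    σσx≈x = begin
      σ (σ x)          ≈⟨ σ-cong σx≈1+x ⟩
      σ (1# + x)       ≈⟨ σ-+ 1# x ⟩
      σ 1# + σ x       ≈⟨ +-cong σ-1 σx≈1+x ⟩
      1# + (1# + x)    ≈⟨ solve 1 (λ x → :1 :+ (:1 :+ x) := x) refl x ⟩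
      x                ∎

  N : Op₁
  N x = x * σ x

  N-cong : Congruent _≈_ _≈_ N
  N-cong x≈y = *-cong x≈y (σ-cong x≈y)

  N-* : ∀ x y → N (x * y) ≈ N x * N y
  N-* x y = trans (*-congˡ (σ-* x y))
    (solve 4 (λ x y sx sy → x :* y :* (sx :* sy) := x :* sx :* (y :* sy)) refl x y (σ x) (σ y))

  N-0 : N 0# ≈ 0#
  N-0 = zeroˡ _

  N≈0⇒≈0 : ∀ {x} → N x ≈ 0# → x ≈ 0#
  N≈0⇒≈0 {x} Nx≈0 with x ≟ 0#
  ... | yes x≈0 = x≈0
  ... | no x≉0 = contradiction σx≈0 σx≉0
    where
    σx≈0 : σ x ≈ 0#
    σx≈0 = *≈0⇒≈0 x≉0 Nx≈0
    σx≉0 : σ x ≉ 0#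
    σx≉0 = *≈1⇒≉0 (trans (sym (σ-* x (inv x))) (trans (σ-cong (inverseʳ x≉0)) σ-1))

  -- Applying σ to x σ(x) = 1 and comparing with the original shows that σ² fixes `x`. Then σ does
  -- too, so `x` is 0 or 1.
  N≈1⇒≈1 : ∀ {x} → N x ≈ 1# → x ≈ 1#
  N≈1⇒≈1 {x} Nx≈1 with fixed (σσ-fixed⇒σ-fixed σσx≈x)
    where
    σσx≈x : σ (σ x) ≈ x
    σσx≈x = *-cancelˡ-nonZero (*≈1⇒≉0 (trans (*-comm _ _) Nx≈1)) (begin
      σ x * σ (σ x)    ≈⟨ σ-* x (σ x) ⟨
      σ (x * σ x)      ≈⟨ σ-cong Nx≈1 ⟩
      σ 1#             ≈⟨ σ-1 ⟩
      1#               ≈⟨ Nx≈1 ⟨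
      x * σ x          ≈⟨ *-comm _ _ ⟩
      σ x * x          ∎)
  ... | inj₁ x≈0 = contradiction x≈0 (*≈1⇒≉0 Nx≈1)
  ... | inj₂ x≈1 = x≈1

  -- As `N` is multiplicative, this reduces to `N≈1⇒≈1` for the quotient of `x` by `y`.
  N-injective : Injective _≈_ _≈_ N
  N-injective {x} {y} Nx≈Ny with y ≟ 0#
  ... | yes y≈0 = trans (N≈0⇒≈0 (trans Nx≈Ny (trans (N-cong y≈0) N-0))) (sym y≈0)
  ... | no y≉0 = begin
    x                 ≈⟨ *-identityʳ x ⟨
    x * 1#            ≈⟨ *-congˡ (inverseʳ y≉0) ⟨
    x * (y * inv y)   ≈⟨ solve 3 (λ x y v → x :* (y :* v) := x :* v :* y) refl x y (inv y) ⟩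
    x * inv y * y     ≈⟨ *-congʳ (N≈1⇒≈1 N≈1) ⟩
    1# * y            ≈⟨ *-identityˡ y ⟩
    y                 ∎
    where
    N≈1 : N (x * inv y) ≈ 1#
    N≈1 = begin
      N (x * inv y)     ≈⟨ N-* x (inv y) ⟩
      N x * N (inv y)   ≈⟨ *-congʳ Nx≈Ny ⟩
      N y * N (inv y)   ≈⟨ N-* y (inv y) ⟨
      N (y * inv y)     ≈⟨ N-cong (inverseʳ y≉0) ⟩
      N 1#              ≈⟨ trans (*-identityˡ _) σ-1 ⟩
      1#                ∎

  -- In F[ω] with ω² = ω + 1, extend σ by σ ω = ω.  Then
  -- (x + yω) σ(x + yω) = A x y + B x y ω.
  A B : Carrier → Carrier → Carrier
  A x y = N x + N y
  B x y = N y + x * σ y + y * σ x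

  A-cong : ∀ {x x′ y y′} → x ≈ x′ → y ≈ y′ → A x y ≈ A x′ y′
  A-cong p q = +-cong (N-cong p) (N-cong q)

  B-cong : ∀ {x x′ y y′} → x ≈ x′ → y ≈ y′ → B x y ≈ B x′ y′
  B-cong p q = +-cong (+-cong (N-cong q) (*-cong p (σ-cong q))) (*-cong q (σ-cong p))

  B-scale : ∀ t x y → B (t * x) (t * y) ≈ N t * B x y
  B-scale t x y = trans
    (+-cong (+-cong (N-* t y) (*-congˡ (σ-* t y))) (*-congˡ (σ-* t x)))
    (solve 6 (λ t x y st sx sy →
        t :* st :* (y :* sy) :+ t :* x :* (st :* sy) :+ t :* y :* (st :* sx)
        := t :* st :* (y :* sy :+ x :* sy :+ y :* sx)) refl t x y (σ t) (σ x) (σ y))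

  -- If `y` were nonzero, scaling by its inverse would reduce to `y = 1`, and `B z 1#` equals z +
  -- σ(z) + 1, which `σx≉1+x` keeps from vanishing.
  B≈0⇒≈0 : ∀ {x y} → B x y ≈ 0# → y ≈ 0#
  B≈0⇒≈0 {x} {y} Bxy≈0 with y ≟ 0#
  ... | yes y≈0 = y≈0
  ... | no y≉0 = contradiction σz≈1+z σx≉1+x
    where
    z : Carrier
    z = inv y * x
    B≈0 : B z 1# ≈ 0#
    B≈0 = begin
      B z 1#                      ≈⟨ B-cong refl (trans (*-comm _ _) (inverseʳ y≉0)) ⟨
      B (inv y * x) (inv y * y)   ≈⟨ B-scale (inv y) x y ⟩
      N (inv y) * B x y           ≈⟨ *-congˡ Bxy≈0 ⟩
      N (inv y) * 0#              ≈⟨ zeroʳ _ ⟩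
      0#                          ∎
    σz≈1+z : σ z ≈ 1# + z
    σz≈1+z = x+y≈0⇒x≈y (begin
      σ z + (1# + z)
        ≈⟨ solve 2 (λ z sz → sz :+ (:1 :+ z) := :1 :* :1 :+ z :* :1 :+ :1 :* sz) refl z (σ z) ⟩
      1# * 1# + z * 1# + 1# * σ z         ≈⟨ +-congʳ (+-cong (*-congˡ σ-1) (*-congˡ σ-1)) ⟨
      B z 1#                              ≈⟨ B≈0 ⟩
      0#                                  ∎)

  -- Instead of a quotient in F[ω], the second case takes the product u + vω with a conjugate. Its
  -- image under w ↦ w σ(w) has ω-component A B′ + B A′, which vanishes when the images agree, so v
  -- = 0 and (x, y) is a multiple of (x′, y′) by some `t` in F. If `y′` is zero, so is `y`, and `N`
  -- alone determines `x`.
  AB-injective : ∀ {x y x′ y′} → A x y ≈ A x′ y′ → B x y ≈ B x′ y′ → x ≈ x′ × y ≈ y′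
  AB-injective {x} {y} {x′} {y′} A≈ B≈ with y′ ≟ 0#
  ... | yes y′≈0 = N-injective (+-cancelʳ (N y′) (trans (+-congˡ (N-cong (sym y≈y′))) A≈)) , y≈y′
    where
    B′≈0 : B x′ y′ ≈ 0#
    B′≈0 = begin
      B x′ y′                          ≈⟨ B-cong refl y′≈0 ⟩
      0# * σ 0# + x′ * σ 0# + 0# * σ x′ ≈⟨ +-congʳ (+-cong (*-congˡ σ-0) (*-congˡ σ-0)) ⟩
      0# * 0# + x′ * 0# + 0# * σ x′
        ≈⟨ solve 2 (λ x sx → :0 :* :0 :+ x :* :0 :+ :0 :* sx := :0) refl x′ (σ x′) ⟩
      0#                                ∎
    y≈y′ : y ≈ y′
    y≈y′ = trans (B≈0⇒≈0 (trans B≈ B′≈0)) (sym y′≈0)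
  ... | no y′≉0 = trans (sym x≈tx′) (trans (*-congʳ t≈1) (*-identityˡ x′))
                , trans (sym y≈ty′) (trans (*-congʳ t≈1) (*-identityˡ y′))
    where
    t u v : Carrier
    t = y * inv y′
    u = x * x′ + x * y′ + y * y′
    v = x * y′ + y * x′

    σu : σ u ≈ σ x * σ x′ + σ x * σ y′ + σ y * σ y′
    σu = trans (σ-+ _ _) (+-cong (trans (σ-+ _ _) (+-cong (σ-* _ _) (σ-* _ _))) (σ-* _ _))

    σv : σ v ≈ σ x * σ y′ + σ y * σ x′
    σv = trans (σ-+ _ _) (+-cong (σ-* _ _) (σ-* _ _))

    -- u + vω is the product of x + yω and the conjugate of x′ + y′ω.
    Buv≈0 : B u v ≈ 0#
    Buv≈0 = begin
      B u v                                  ≈⟨ +-cong (+-cong (*-congˡ σv) (*-congˡ σv)) (*-congˡ σu) ⟩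
      _                                      ≈⟨ solve 8 (λ x y x′ y′ sx sy sx′ sy′ →
          let u = x :* x′ :+ x :* y′ :+ y :* y′
              v = x :* y′ :+ y :* x′
              su = sx :* sx′ :+ sx :* sy′ :+ sy :* sy′
              sv = sx :* sy′ :+ sy :* sx′
          in v :* sv :+ u :* sv :+ v :* su
             := (x :* sx :+ y :* sy) :* (y′ :* sy′ :+ x′ :* sy′ :+ y′ :* sx′)
                :+ (y :* sy :+ x :* sy :+ y :* sx) :* (x′ :* sx′ :+ y′ :* sy′))
          refl x y x′ y′ (σ x) (σ y) (σ x′) (σ y′) ⟩
      A x y * B x′ y′ + B x y * A x′ y′      ≈⟨ +-cong (*-congʳ A≈) (*-congʳ B≈) ⟩
      A x′ y′ * B x′ y′ + B x′ y′ * A x′ y′  ≈⟨ solve 2 (λ a b → a :* b :+ b :* a := :0) refl _ _ ⟩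
      0#                                     ∎

    xy′≈yx′ : x * y′ ≈ y * x′
    xy′≈yx′ = x+y≈0⇒x≈y (B≈0⇒≈0 Buv≈0)

    x≈tx′ : t * x′ ≈ x
    x≈tx′ = begin
      y * inv y′ * x′     ≈⟨ solve 3 (λ y v x → y :* v :* x := y :* x :* v) refl y (inv y′) x′ ⟩
      y * x′ * inv y′     ≈⟨ *-congʳ xy′≈yx′ ⟨
      x * y′ * inv y′     ≈⟨ *-assoc _ _ _ ⟩
      x * (y′ * inv y′)   ≈⟨ *-congˡ (inverseʳ y′≉0) ⟩
      x * 1#              ≈⟨ *-identityʳ x ⟩
      x                   ∎

    y≈ty′ : t * y′ ≈ y
    y≈ty′ = begin
      y * inv y′ * y′     ≈⟨ *-assoc _ _ _ ⟩
      y * (inv y′ * y′)   ≈⟨ *-congˡ (trans (*-comm _ _) (inverseʳ y′≉0)) ⟩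
      y * 1#              ≈⟨ *-identityʳ y ⟩
      y                   ∎

    t≈1 : t ≈ 1#
    -- `B x′ y′` is nonzero because `y′` is, so it cancels from the scaling law and leaves
    -- `N t ≈ 1#`.
    t≈1 = N≈1⇒≈1 (*-cancelˡ-nonZero (y′≉0 ∘ B≈0⇒≈0) (begin
      B x′ y′ * N t            ≈⟨ *-comm _ _ ⟩
      N t * B x′ y′            ≈⟨ B-scale t x′ y′ ⟨
      B (t * x′) (t * y′)      ≈⟨ B-cong x≈tx′ y≈ty′ ⟩
      B x y                    ≈⟨ B≈ ⟩
      B x′ y′                  ≈⟨ *-identityʳ _ ⟨
      B x′ y′ * 1#             ∎))

  σ-linear : ∀ a b x y → σ (a * x + b * y) ≈ σ a * σ x + σ b * σ y
  σ-linear a b x y = trans (σ-+ _ _) (+-cong (σ-* a x) (σ-* b y))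

  module _ (α β : Carrier) where

    Rσ : Carrier → Carrier → Carrier
    Rσ x y = N (x + α * y) + N (β * y)

    Rσ-cong : ∀ {x x′ y y′} → x ≈ x′ → y ≈ y′ → Rσ x y ≈ Rσ x′ y′
    Rσ-cong p q = +-cong (N-cong (+-cong p (*-congˡ q))) (N-cong (*-congˡ q))

    module _ (α≉0 : α ≉ 0#) (β≉0 : β ≉ 0#) (condition : α * α + α * β + β * β ≈ 1#) where

      -- Put γ = α + βω and let ū be the conjugate of u = X + Yω. The condition says that γ has norm
      -- 1 over F, and it gives (y + αx) + βxω = γū. Hence `Rσ y x` is the constant component of γ
      -- σ(γ) times the conjugate of `A X Y` + `B X Y` ω, and `A α β + B α β` equals `B β α`.
      Rσ-swap : ∀ x y → let X = x + α * y ; Y = β * y in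
                Rσ y x ≈ A α β * A X Y + B β α * B X Y
      Rσ-swap x y = begin
        Rσ y x                                          ≈⟨ +-cong (N-cong eq₁) (N-cong eq₂) ⟩
        N (α * X + (α + β) * Y) + N (β * X + α * Y)     ≈⟨ +-cong (*-congˡ (trans (σ-linear α (α + β) X Y)
                                                             (+-congˡ (*-congʳ (σ-+ α β)))))
                                                             (*-congˡ (σ-linear β α X Y)) ⟩
        _                                               ≈⟨ solve 8 (λ α β X Y sα sβ sX sY →
            (α :* X :+ (α :+ β) :* Y) :* (sα :* sX :+ (sα :+ sβ) :* sY) :+ (β :* X :+ α :* Y) :* (sβ :* sX :+ sα :* sY)
            := (α :* sα :+ β :* sβ) :* (X :* sX :+ Y :* sY)
               :+ (α :* sα :+ β :* sα :+ α :* sβ) :* (Y :* sY :+ X :* sY :+ Y :* sX))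
            refl α β X Y (σ α) (σ β) (σ X) (σ Y) ⟩
        A α β * A X Y + B β α * B X Y                   ∎
        where
        X Y : Carrier
        X = x + α * y
        Y = β * y
        eq₁ : y + α * x ≈ α * X + (α + β) * Y
        eq₁ = begin
          y + α * x                               ≈⟨ +-congʳ (*-identityˡ y) ⟨
          1# * y + α * x                          ≈⟨ +-congʳ (*-congʳ condition) ⟨
          (α * α + α * β + β * β) * y + α * x
            ≈⟨ solve 4 (λ α β x y → (α :* α :+ α :* β :+ β :* β) :* y :+ α :* x
                                                       := α :* (x :+ α :* y) :+ (α :+ β) :* (β :* y)) refl α β x y ⟩
          α * X + (α + β) * Y                     ∎
        eq₂ : β * x ≈ β * X + α * Y
        eq₂ = solve 4 (λ α β x y → β :* x := β :* (x :+ α :* y) :+ α :* (β :* y)) refl α β x y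

      -- The first component of the image is `A X Y`. By `Rσ-swap` the second then determines
      -- `B X Y`, whose coefficient `B β α` is nonzero because α is.
      sufficient : ∀ {x y x′ y′} → Rσ x y ≈ Rσ x′ y′ → Rσ y x ≈ Rσ y′ x′ → x ≈ x′ × y ≈ y′
      sufficient {x} {y} {x′} {y′} eq eqˢ = x≈x′ , y≈y′
        where
        B≈ : B (x + α * y) (β * y) ≈ B (x′ + α * y′) (β * y′)
        B≈ = *-cancelˡ-nonZero (α≉0 ∘ B≈0⇒≈0) (+-cancelʳ (A α β * A (x + α * y) (β * y)) (begin
          B β α * B (x + α * y) (β * y) + A α β * A (x + α * y) (β * y)        ≈⟨ +-comm _ _ ⟩
          A α β * A (x + α * y) (β * y) + B β α * B (x + α * y) (β * y)        ≈⟨ Rσ-swap x y ⟨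
          Rσ y x                                                              ≈⟨ eqˢ ⟩
          Rσ y′ x′                                                            ≈⟨ Rσ-swap x′ y′ ⟩
          A α β * A (x′ + α * y′) (β * y′) + B β α * B (x′ + α * y′) (β * y′)  ≈⟨ +-comm _ _ ⟩
          B β α * B (x′ + α * y′) (β * y′) + A α β * A (x′ + α * y′) (β * y′)  ≈⟨ +-congˡ (*-congˡ eq) ⟨
          B β α * B (x′ + α * y′) (β * y′) + A α β * A (x + α * y) (β * y)     ∎))
        y≈y′ : y ≈ y′
        y≈y′ = *-cancelˡ-nonZero β≉0 (proj₂ (AB-injective eq B≈))
        x≈x′ : x ≈ x′
        x≈x′ = +-cancelʳ (α * y) (trans (proj₁ (AB-injective eq B≈)) (+-congˡ (*-congˡ (sym y≈y′))))

-- Trace sums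

parity : ∀ n → ∃ λ a → n ≡ a ℕ.+ a ⊎ n ≡ suc (a ℕ.+ a)
parity zero = 0 , inj₁ ≡.refl
parity (suc n) with parity n
... | a , inj₁ ≡.refl = a , inj₂ ≡.refl
... | a , inj₂ ≡.refl = suc a , inj₁ (≡.cong suc (≡.sym (ℕ.+-suc a a)))

a+a<b+b⇒a<b : ∀ {a b} → a ℕ.+ a ℕ.< b ℕ.+ b → a ℕ.< b
a+a<b+b⇒a<b {a} {b} lt = ℕ.≰⇒> λ b≤a → ℕ.<⇒≱ lt (ℕ.+-mono-≤ b≤a b≤a)

module Trace {q : ℕ} {c r : Level} {F : FiniteField q c r} (Φ : OddAutomorphism F) where
  open Norm Φ public
  open SetoidReasoning setoid

  σ^ : ℕ → Op₁
  σ^ n x = fold x σ n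

  order : ℕ
  order = suc (half ℕ.+ half)

  σ^-cong : ∀ n → Congruent _≈_ _≈_ (σ^ n)
  σ^-cong zero    x≈y = x≈y
  σ^-cong (suc n) x≈y = σ-cong (σ^-cong n x≈y)

  σ^-+ : ∀ n x y → σ^ n (x + y) ≈ σ^ n x + σ^ n y
  σ^-+ zero    x y = refl
  σ^-+ (suc n) x y = trans (σ-cong (σ^-+ n x y)) (σ-+ _ _)

  σ^-* : ∀ n x y → σ^ n (x * y) ≈ σ^ n x * σ^ n y
  σ^-* zero    x y = refl
  σ^-* (suc n) x y = trans (σ-cong (σ^-* n x y)) (σ-* _ _)

  σ^-1 : ∀ n → σ^ n 1# ≈ 1#
  σ^-1 zero    = refl
  σ^-1 (suc n) = trans (σ-cong (σ^-1 n)) σ-1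

  σ^-0 : ∀ n → σ^ n 0# ≈ 0#
  σ^-0 zero    = refl
  σ^-0 (suc n) = trans (σ-cong (σ^-0 n)) σ-0

  σ^-σ : ∀ n x → σ^ n (σ x) ≡ σ (σ^ n x)
  σ^-σ zero    x = ≡.refl
  σ^-σ (suc n) x = ≡.cong σ (σ^-σ n x)

  σ^-∘ : ∀ m n x → σ^ (m ℕ.+ n) x ≡ σ^ m (σ^ n x)
  σ^-∘ zero    n x = ≡.refl
  σ^-∘ (suc m) n x = ≡.cong σ (σ^-∘ m n x)

  -- Equal values make σ(x + y), and with it `N (x + y)`, vanish.
  σ-injective : Injective _≈_ _≈_ σ
  σ-injective {x} {y} eq = x+y≈0⇒x≈y (N≈0⇒≈0 (begin
    (x + y) * σ (x + y)    ≈⟨ *-congˡ (trans (σ-+ x y) (trans (+-congʳ eq) (x+x≈0 _))) ⟩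
    (x + y) * 0#           ≈⟨ zeroʳ _ ⟩
    0#                     ∎))

  σ^-injective : ∀ n → Injective _≈_ _≈_ (σ^ n)
  σ^-injective zero    eq = eq
  σ^-injective (suc n) eq = σ^-injective n (σ-injective eq)

  -- An odd exponent contradicts `minimal` directly. An even exponent 2a + 2 is subtracted from
  -- `order`, which leaves the odd exponent 1 + 2e with e = half - (a + 1), also too small.
  σ^-nontrivial : ∀ {j} → j ℕ.< half ℕ.+ half → ¬ (∀ x → σ^ (suc j) x ≈ x)
  σ^-nontrivial {j} j<2h trivial with parity j
  ... | a , inj₁ ≡.refl = minimal {a} (a+a<b+b⇒a<b j<2h) trivial
  ... | a , inj₂ ≡.refl = minimal {e} e<h (λ x → begin
    σ^ (suc (e ℕ.+ e)) x                                ≈⟨ σ^-cong (suc (e ℕ.+ e)) (trivial x) ⟨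
    σ^ (suc (e ℕ.+ e)) (σ^ (suc (suc (a ℕ.+ a))) x)     ≡⟨ σ^-∘ (suc (e ℕ.+ e)) (suc (suc (a ℕ.+ a))) x ⟨
    σ^ (suc (e ℕ.+ e) ℕ.+ suc (suc (a ℕ.+ a))) x        ≡⟨ ≡.cong (λ k → σ^ k x) sum-order ⟩
    σ^ order x                                          ≈⟨ odd-order x ⟩
    x                                                   ∎)
    where
    a<h : a ℕ.< half
    a<h = a+a<b+b⇒a<b (ℕ.<-trans (ℕ.n<1+n _) j<2h)
    e : ℕ
    e = half ℕ.∸ suc a
    e<h : e ℕ.< half
    e<h = ℕ.∸-monoʳ-< (ℕ.s≤s ℕ.z≤n) a<h
    e+1+a : e ℕ.+ suc a ≡ half
    e+1+a = ℕ.m∸n+n≡m a<h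
    sum-order : suc (e ℕ.+ e) ℕ.+ suc (suc (a ℕ.+ a)) ≡ order
    sum-order = ≡.cong suc (≡-Reasoning.begin
      e ℕ.+ e ℕ.+ suc (suc (a ℕ.+ a))      ≡-Reasoning.≡⟨ ≡.cong (λ k → e ℕ.+ e ℕ.+ suc k) (ℕ.+-suc a a) ⟨
      e ℕ.+ e ℕ.+ (suc a ℕ.+ suc a)        ≡-Reasoning.≡⟨ exchange e (suc a) ⟩
      (e ℕ.+ suc a) ℕ.+ (e ℕ.+ suc a)      ≡-Reasoning.≡⟨ ≡.cong₂ ℕ._+_ e+1+a e+1+a ⟩
      half ℕ.+ half                        ≡-Reasoning.∎)
      where

      open +-*-Solver renaming (solve to solveℕ; _:+_ to _⊕_; _:=_ to _⊜_)
      exchange : ∀ m n → m ℕ.+ m ℕ.+ (n ℕ.+ n) ≡ (m ℕ.+ n) ℕ.+ (m ℕ.+ n)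
      exchange = solveℕ 2 (λ m n → m ⊕ m ⊕ (n ⊕ n) ⊜ (m ⊕ n) ⊕ (m ⊕ n)) ≡.refl

  inv-* : ∀ x y → inv (x * y) ≈ inv x * inv y
  inv-* x y = by-cases (x ≟ 0#) (y ≟ 0#)
    where
    by-cases : Dec (x ≈ 0#) → Dec (y ≈ 0#) → inv (x * y) ≈ inv x * inv y
    by-cases (yes x≈0) _ = trans (inv-zero (trans (*-congʳ x≈0) (zeroˡ y)))
      (sym (trans (*-congʳ (inv-zero x≈0)) (zeroˡ _)))
    by-cases (no _) (yes y≈0) = trans (inv-zero (trans (*-congˡ y≈0) (zeroʳ x)))
      (sym (trans (*-congˡ (inv-zero y≈0)) (zeroʳ _)))
    by-cases (no x≉0) (no y≉0) = inv-unique (begin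
      x * y * (inv x * inv y)
        ≈⟨ solve 4 (λ x y u v → x :* y :* (u :* v) := x :* u :* (y :* v)) refl x y (inv x) (inv y) ⟩
      x * inv x * (y * inv y)       ≈⟨ *-cong (inverseʳ x≉0) (inverseʳ y≉0) ⟩
      1# * 1#                       ≈⟨ *-identityˡ 1# ⟩
      1#                            ∎)

  -- Adding `1#` to every term leaves the sum unchanged by `∑1≈0`, and afterwards only the term at
  -- zero survives.
  ∑x·x⁻¹≈1 : ∑ (λ x → x * inv x) ≈ 1#
  ∑x·x⁻¹≈1 = begin
    ∑ (λ x → x * inv x)                        ≈⟨ +-identityʳ _ ⟨
    ∑ (λ x → x * inv x) + 0#                   ≈⟨ +-congˡ ∑1≈0 ⟨
    ∑ (λ x → x * inv x) + ∑ (λ _ → 1#)         ≈⟨ ∑-∙ (λ x → x * inv x) (λ _ → 1#) ⟨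
    ∑ (λ x → x * inv x + 1#)                   ≈⟨ ∑-single 0# (λ x≈y → +-congʳ (*-cong x≈y (inv-cong x≈y)))
                                                    (λ x x≉0 → trans (+-congʳ (inverseʳ x≉0)) 1+1≈0) ⟩
    0# * inv 0# + 1#                           ≈⟨ trans (+-congʳ (zeroˡ _)) (+-identityˡ 1#) ⟩
    1#                                         ∎

  -- The summand is multiplicative in `x`, so replacing `x` by a x multiplies the sum by its value
  -- at `a`. A nonzero sum would make all values at nonzero `a` equal to 1, that is, make this power
  -- of σ the identity.
  ∑σ^x·x⁻¹≈0 : ∀ {j} → j ℕ.< half ℕ.+ half → ∑ (λ x → σ^ (suc j) x * inv x) ≈ 0#
  ∑σ^x·x⁻¹≈0 {j} j<2h with ∑ (λ x → σ^ (suc j) x * inv x) ≟ 0#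
  ... | yes S≈0 = S≈0
  ... | no S≉0 = contradiction trivial (σ^-nontrivial j<2h)
    where
    S : Carrier
    S = ∑ (λ x → σ^ (suc j) x * inv x)
    scaled : ∀ {a} → a ≉ 0# → S ≈ S * (σ^ (suc j) a * inv a)
    scaled {a} a≉0 = begin
      S
        ≈⟨ ∑-reindex (a *_) (λ x≈y → *-cong (σ^-cong (suc j) x≈y) (inv-cong x≈y))
                                                                        *-congˡ (*-cancelˡ-nonZero a≉0) ⟩
      ∑ (λ x → σ^ (suc j) (a * x) * inv (a * x))
        ≈⟨ ∑-cong (λ x → trans (*-cong (σ^-* (suc j) a x) (inv-* a x))
          (solve 4 (λ u v w z → u :* v :* (w :* z) := u :* w :* (v :* z)) refl
             (σ^ (suc j) a) (σ^ (suc j) x) (inv a) (inv x))) ⟩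
      ∑ (λ x → σ^ (suc j) a * inv a * (σ^ (suc j) x * inv x))
        ≈⟨ ∑-*ˡ (σ^ (suc j) a * inv a) (λ x → σ^ (suc j) x * inv x) ⟩
      σ^ (suc j) a * inv a * S                                     ≈⟨ *-comm _ _ ⟩
      S * (σ^ (suc j) a * inv a)                                   ∎
    trivial : ∀ x → σ^ (suc j) x ≈ x
    trivial x with x ≟ 0#
    ... | yes x≈0 = trans (σ^-cong (suc j) x≈0) (trans (σ^-0 (suc j)) (sym x≈0))
    ... | no x≉0 = begin
      σ^ (suc j) x                    ≈⟨ *-identityʳ _ ⟨
      σ^ (suc j) x * 1#               ≈⟨ *-congˡ (inverseʳ x≉0) ⟨
      σ^ (suc j) x * (x * inv x)
        ≈⟨ solve 3 (λ s x v → s :* (x :* v) := s :* v :* x) refl (σ^ (suc j) x) x (inv x) ⟩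
      σ^ (suc j) x * inv x * x
        ≈⟨ *-congʳ (*-cancelˡ-nonZero S≉0 (trans (sym (scaled x≉0)) (sym (*-identityʳ S)))) ⟩
      1# * x                          ≈⟨ *-identityˡ x ⟩
      x                               ∎

  partialTrace : ℕ → Op₁
  partialTrace zero    x = 0#
  partialTrace (suc n) x = σ^ n x + partialTrace n x

  partialTrace-cong : ∀ n → Congruent _≈_ _≈_ (partialTrace n)
  partialTrace-cong zero    x≈y = refl
  partialTrace-cong (suc n) x≈y = +-cong (σ^-cong n x≈y) (partialTrace-cong n x≈y)

  partialTrace-+ : ∀ n x y → partialTrace n (x + y) ≈ partialTrace n x + partialTrace n y
  partialTrace-+ zero    x y = sym (+-identityˡ 0#)
  partialTrace-+ (suc n) x y = trans (+-cong (σ^-+ n x y) (partialTrace-+ n x y))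
    (solve 4 (λ a b c d → a :+ b :+ (c :+ d) := a :+ c :+ (b :+ d)) refl _ _ _ _)

  σ-partialTrace : ∀ n x → σ (partialTrace n x) ≈ partialTrace n (σ x)
  σ-partialTrace zero    x = σ-0
  σ-partialTrace (suc n) x = trans (σ-+ _ _) (+-cong (reflexive (≡.sym (σ^-σ n x))) (σ-partialTrace n x))

  partialTrace-telescope : ∀ n x → partialTrace n x + partialTrace n (σ x) ≈ x + σ^ n x
  partialTrace-telescope zero    x = trans (+-identityˡ 0#) (sym (x+x≈0 x))
  partialTrace-telescope (suc n) x = begin
    σ^ n x + partialTrace n x + (σ^ n (σ x) + partialTrace n (σ x))
      ≈⟨ solve 4 (λ a b c d → a :+ b :+ (c :+ d) := b :+ d :+ (a :+ c)) refl _ _ _ _ ⟩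
    partialTrace n x + partialTrace n (σ x) + (σ^ n x + σ^ n (σ x))
      ≈⟨ +-cong (partialTrace-telescope n x) (+-congˡ (reflexive (σ^-σ n x))) ⟩
    x + σ^ n x + (σ^ n x + σ^ (suc n) x)
      ≈⟨ solve 3 (λ x a b → x :+ a :+ (a :+ b) := x :+ b) refl x (σ^ n x) (σ^ (suc n) x) ⟩
    x + σ^ (suc n) x                                                    ∎

  Tr : Op₁
  Tr = partialTrace order

  Tr-cong : Congruent _≈_ _≈_ Tr
  Tr-cong = partialTrace-cong order

  Tr-+ : ∀ x y → Tr (x + y) ≈ Tr x + Tr y
  Tr-+ = partialTrace-+ order

  Tr-σ : ∀ x → Tr (σ x) ≈ Tr x
  Tr-σ x = sym (x+y≈0⇒x≈y (trans (partialTrace-telescope order x) (trans (+-congˡ (odd-order x)) (x+x≈0 x))))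

  Tr≈0⊎1 : ∀ x → Tr x ≈ 0# ⊎ Tr x ≈ 1#
  Tr≈0⊎1 x = fixed (trans (σ-partialTrace order x) (Tr-σ x))

  Tr-0 : Tr 0# ≈ 0#
  Tr-0 = vanishes order
    where
    vanishes : ∀ n → partialTrace n 0# ≈ 0#
    vanishes zero    = refl
    vanishes (suc n) = trans (+-cong (σ^-0 n) (vanishes n)) (+-identityˡ 0#)

  -- The trace of 1 adds up an odd number of ones.
  Tr-1 : Tr 1# ≈ 1#
  Tr-1 = odd half
    where
    odd : ∀ n → partialTrace (suc (n ℕ.+ n)) 1# ≈ 1#
    odd zero = +-identityʳ 1#
    odd (suc n) rewrite ℕ.+-suc n n = begin
      σ^ (suc (suc (n ℕ.+ n))) 1# + (σ^ (suc (n ℕ.+ n)) 1# + partialTrace (suc (n ℕ.+ n)) 1#)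
        ≈⟨ +-cong (σ^-1 (suc (suc (n ℕ.+ n)))) (+-cong (σ^-1 (suc (n ℕ.+ n))) (odd n)) ⟩
      1# + (1# + 1#)       ≈⟨ solve 0 (:1 :+ (:1 :+ :1) := :1) refl ⟩
      1#                   ∎

  Tr-Tr : ∀ x → Tr (Tr x) ≈ Tr x
  Tr-Tr x with Tr≈0⊎1 x
  ... | inj₁ Tr≈0 = trans (Tr-cong Tr≈0) (trans Tr-0 (sym Tr≈0))
  ... | inj₂ Tr≈1 = trans (Tr-cong Tr≈1) (trans Tr-1 (sym Tr≈1))

  -- Expanding the trace, the identity contributes 1 and each nontrivial power of σ contributes 0.
  ∑Tr·inv≈1 : ∑ (λ x → Tr x * inv x) ≈ 1#
  ∑Tr·inv≈1 = partial (half ℕ.+ half) ℕ.≤-refl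
    where
    partial : ∀ n → n ℕ.≤ half ℕ.+ half → ∑ (λ x → partialTrace (suc n) x * inv x) ≈ 1#
    partial zero    _ = trans (∑-cong (λ x → *-congʳ {inv x} (+-identityʳ x))) ∑x·x⁻¹≈1
    partial (suc n) n<2h = begin
      ∑ (λ x → (σ^ (suc n) x + partialTrace (suc n) x) * inv x)
        ≈⟨ ∑-cong (λ x → distribʳ (inv x) (σ^ (suc n) x) (partialTrace (suc n) x)) ⟩
      ∑ (λ x → σ^ (suc n) x * inv x + partialTrace (suc n) x * inv x)
        ≈⟨ ∑-∙ (λ x → σ^ (suc n) x * inv x) (λ x → partialTrace (suc n) x * inv x) ⟩
      ∑ (λ x → σ^ (suc n) x * inv x) + ∑ (λ x → partialTrace (suc n) x * inv x)
        ≈⟨ +-cong (∑σ^x·x⁻¹≈0 n<2h) (partial n (ℕ.<⇒≤ n<2h)) ⟩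
      0# + 1#                                                                            ≈⟨ +-identityˡ 1# ⟩
      1#                                                                                 ∎

  x+1-injective : Injective _≈_ _≈_ (_+ 1#)
  x+1-injective = +-cancelʳ 1#

  -- Each pair {x, x + 1} has exactly one element of trace 1.
  ∑-half : ∀ {f} → Congruent _≈_ _≈_ f → ∑ f ≈ ∑ (λ x → Tr x * (f x + f (x + 1#)))
  ∑-half {f} f-cong = begin
    ∑ f                                                          ≈⟨ ∑-cong split ⟩
    ∑ (λ x → Tr x * f x + Tr (x + 1#) * f x)
      ≈⟨ ∑-∙ (λ x → Tr x * f x) (λ x → Tr (x + 1#) * f x) ⟩
    ∑ (λ x → Tr x * f x) + ∑ (λ x → Tr (x + 1#) * f x)           ≈⟨ +-congˡ (∑-reindex (_+ 1#)
                                                                      (λ x≈y → *-cong (Tr-cong (+-congʳ x≈y)) (f-cong x≈y)) +-congʳ x+1-injective) ⟩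
    ∑ (λ x → Tr x * f x) + ∑ (λ x → Tr (x + 1# + 1#) * f (x + 1#))
      ≈⟨ +-congˡ (∑-cong (λ x → *-congʳ {f (x + 1#)} (Tr-cong
                                                                      (solve 1 (λ x → x :+ :1 :+ :1 := x) refl x)))) ⟩
    ∑ (λ x → Tr x * f x) + ∑ (λ x → Tr x * f (x + 1#))
      ≈⟨ ∑-∙ (λ x → Tr x * f x) (λ x → Tr x * f (x + 1#)) ⟨
    ∑ (λ x → Tr x * f x + Tr x * f (x + 1#))
      ≈⟨ ∑-cong (λ x → distribˡ (Tr x) (f x) (f (x + 1#))) ⟨
    ∑ (λ x → Tr x * (f x + f (x + 1#)))                          ∎
    where
    split : ∀ x → f x ≈ Tr x * f x + Tr (x + 1#) * f x
    split x = sym (begin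
      Tr x * f x + Tr (x + 1#) * f x         ≈⟨ +-congˡ (*-congʳ (trans (Tr-+ x 1#) (+-congˡ Tr-1))) ⟩
      Tr x * f x + (Tr x + 1#) * f x
        ≈⟨ solve 2 (λ t y → t :* y :+ (t :+ :1) :* y := y) refl (Tr x) (f x) ⟩
      f x                                    ∎)

  -- For nonzero `x`, D(x) / N(x) is the value of `N w + 1#` at w = x⁻¹ + 1.
  D : Op₁
  D x = x + σ x + 1#

  D-cong : Congruent _≈_ _≈_ D
  D-cong x≈y = +-congʳ (+-cong x≈y (σ-cong x≈y))

  D≉0 : ∀ x → D x ≉ 0#
  D≉0 x D≈0 = σx≉1+x (x+y≈0⇒x≈y (trans (solve 2 (λ x s → s :+ (:1 :+ x) := x :+ s :+ :1) refl x (σ x)) D≈0))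

  -- A permutation preserving the trace and agreeing with D on trace 1, so it
  -- turns a sum over w of trace 1 of a function of D w into one over s = D w.
  π : Op₁
  π x = x + σ x + Tr x

  π-cong : Congruent _≈_ _≈_ π
  π-cong x≈y = +-cong (+-cong x≈y (σ-cong x≈y)) (Tr-cong x≈y)

  Tr-π : ∀ x → Tr (π x) ≈ Tr x
  Tr-π x = begin
    Tr (x + σ x + Tr x)              ≈⟨ trans (Tr-+ _ _) (+-congʳ (Tr-+ _ _)) ⟩
    Tr x + Tr (σ x) + Tr (Tr x)      ≈⟨ +-cong (+-congˡ (Tr-σ x)) (Tr-Tr x) ⟩
    Tr x + Tr x + Tr x               ≈⟨ solve 1 (λ t → t :+ t :+ t := t) refl (Tr x) ⟩
    Tr x                             ∎

  -- The difference `z` of two elements with the same image has trace 0, so it is fixed by σ and is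
  -- 0 or 1; `Tr-1` excludes 1.
  π-injective : Injective _≈_ _≈_ π
  π-injective {x} {y} πx≈πy = x+y≈0⇒x≈y z≈0
    where
    z : Carrier
    z = x + y
    Tr-z : Tr z ≈ 0#
    Tr-z = begin
      Tr (x + y)              ≈⟨ Tr-+ x y ⟩
      Tr x + Tr y             ≈⟨ +-cong (Tr-π x) (Tr-π y) ⟨
      Tr (π x) + Tr (π y)     ≈⟨ +-congʳ (Tr-cong πx≈πy) ⟩
      Tr (π y) + Tr (π y)     ≈⟨ x+x≈0 _ ⟩
      0#                      ∎
    σz≈z : σ z ≈ z
    σz≈z = x+y≈0⇒x≈y (begin
      σ (x + y) + (x + y)                                ≈⟨ +-congʳ (σ-+ x y) ⟩
      σ x + σ y + (x + y)                                ≈⟨ solve 6 (λ x y s t a b → s :+ t :+ (x :+ y)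
                                                              := x :+ s :+ a :+ (y :+ t :+ b) :+ (a :+ b)) refl x y (σ x) (σ y) (Tr x) (Tr y) ⟩
      π x + π y + (Tr x + Tr y)
        ≈⟨ +-cong (trans (+-congʳ πx≈πy) (x+x≈0 _)) (trans (sym (Tr-+ x y)) Tr-z) ⟩
      0# + 0#                                            ≈⟨ +-identityˡ 0# ⟩
      0#                                                 ∎)
    z≈0 : z ≈ 0#
    z≈0 with fixed σz≈z
    ... | inj₁ z≈0 = z≈0
    ... | inj₂ z≈1 = contradiction (trans (sym Tr-z) (trans (Tr-cong z≈1) Tr-1)) 0≉1

  ∑Tr·inv-D≈1 : ∑ (λ x → Tr x * inv (D x)) ≈ 1#
  ∑Tr·inv-D≈1 = begin
    ∑ (λ x → Tr x * inv (D x))           ≈⟨ ∑-cong pointwise ⟩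
    ∑ (λ x → Tr (π x) * inv (π x))
      ≈⟨ ∑-reindex π (λ x≈y → *-cong (Tr-cong x≈y) (inv-cong x≈y)) π-cong π-injective ⟨
    ∑ (λ x → Tr x * inv x)               ≈⟨ ∑Tr·inv≈1 ⟩
    1#                                   ∎
    where
    pointwise : ∀ x → Tr x * inv (D x) ≈ Tr (π x) * inv (π x)
    pointwise x with Tr≈0⊎1 x
    ... | inj₁ Tr≈0 = trans (trans (*-congʳ Tr≈0) (zeroˡ _))
                            (sym (trans (*-congʳ (trans (Tr-π x) Tr≈0)) (zeroˡ _)))
    ... | inj₂ Tr≈1 = *-cong (sym (Tr-π x)) (inv-cong (+-congˡ (sym Tr≈1)))

  ∑σ^≈∑ : ∀ n → ∑ (σ^ n) ≈ ∑ id
  ∑σ^≈∑ n = sym (∑-reindex (σ^ n) id (σ^-cong n) (σ^-injective n))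

  -- Among the fields at hand this assumption fails only for 𝔽₂, where the sum is 1.
  module _ (∑≈0 : ∑ id ≈ 0#) where

    ∑Tr≈0 : ∑ Tr ≈ 0#
    ∑Tr≈0 = partial order
      where
      partial : ∀ n → ∑ (partialTrace n) ≈ 0#
      partial zero    = ∑-ε (λ _ → refl)
      partial (suc n) = trans (∑-∙ (σ^ n) (partialTrace n))
        (trans (+-cong (trans (∑σ^≈∑ n) ∑≈0) (partial n)) (+-identityˡ 0#))

    -- The substitution x ↦ x⁻¹ + 1, made in two steps, replaces the denominator by `D`, which is
    -- nowhere zero and invariant under x ↦ x + 1. Pairing `x` with x + 1 then leaves a sum over
    -- elements of trace 1.
    ∑x·inv[1+Nx]≈1 : ∑ (λ x → x * inv (N x + 1#)) ≈ 1#
    ∑x·inv[1+Nx]≈1 = begin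
      ∑ f                                                  ≈⟨ ∑-reindex (_+ 1#) f-cong +-congʳ x+1-injective ⟩
      ∑ (λ x → f (x + 1#))
        ≈⟨ ∑-reindex inv (λ x≈y → f-cong (+-congʳ x≈y)) inv-cong inv-injective ⟩
      ∑ (λ x → f (inv x + 1#))                             ≈⟨ ∑-cong (λ x → f-inv x (x ≟ 0#)) ⟩
      ∑ g                                                  ≈⟨ ∑-half g-cong ⟩
      ∑ (λ x → Tr x * (g x + g (x + 1#)))                  ≈⟨ ∑-cong (λ x → *-congˡ {Tr x} (g-pair x)) ⟩
      ∑ (λ x → Tr x * (1# + inv (D x)))
        ≈⟨ ∑-cong (λ x → trans (distribˡ (Tr x) 1# (inv (D x))) (+-congʳ (*-identityʳ (Tr x)))) ⟩
      ∑ (λ x → Tr x + Tr x * inv (D x))                    ≈⟨ ∑-∙ Tr (λ x → Tr x * inv (D x)) ⟩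
      ∑ Tr + ∑ (λ x → Tr x * inv (D x))                    ≈⟨ +-cong ∑Tr≈0 ∑Tr·inv-D≈1 ⟩
      0# + 1#                                              ≈⟨ +-identityˡ 1# ⟩
      1#                                                   ∎
      where
      f g : Op₁
      f x = x * inv (N x + 1#)
      g x = (x + 1#) * σ x * inv (D x)
      f-cong : Congruent _≈_ _≈_ f
      f-cong x≈y = *-cong x≈y (inv-cong (+-congʳ (N-cong x≈y)))
      g-cong : Congruent _≈_ _≈_ g
      g-cong x≈y = *-cong (*-cong (+-congʳ x≈y) (σ-cong x≈y)) (inv-cong (D-cong x≈y))

      σ-+1 : ∀ x → σ (x + 1#) ≈ σ x + 1#
      σ-+1 x = trans (σ-+ x 1#) (+-congˡ σ-1)

      f-inv : ∀ x → Dec (x ≈ 0#) → f (inv x + 1#) ≈ g x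
      -- At zero both sides vanish: the left because `N 1# + 1#` is zero and `inv` sends it to zero,
      -- the right because of the factor `σ x`.
      f-inv x (yes x≈0) = trans (f-cong (trans (+-congʳ (inv-zero x≈0)) (+-identityˡ 1#))) (trans
        (trans (*-identityˡ _) (inv-zero (trans (+-congʳ (trans (*-identityˡ _) σ-1)) 1+1≈0)))
        (sym (trans (*-congʳ (trans (*-congˡ (trans (σ-cong x≈0) σ-0)) (zeroʳ _))) (zeroˡ _))))
      f-inv x (no x≉0) = begin
        (v + 1#) * inv M                     ≈⟨ *-congˡ (inv-unique M⁻¹) ⟩
        (v + 1#) * (N x * inv (D x))
          ≈⟨ solve 4 (λ x s v i → (v :+ :1) :* (x :* s :* i) := (x :* v :+ x) :* s :* i) refl x (σ x) v (inv (D x)) ⟩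
        (x * v + x) * σ x * inv (D x)        ≈⟨ *-congʳ (*-congʳ (trans (+-congʳ xv≈1) (+-comm _ _))) ⟩
        g x                                  ∎
        where
        v M : Carrier
        v = inv x
        M = N (v + 1#) + 1#
        xv≈1 : x * v ≈ 1#
        xv≈1 = inverseʳ x≉0
        σxσv≈1 : σ x * σ v ≈ 1#
        σxσv≈1 = trans (sym (σ-* x v)) (trans (σ-cong xv≈1) σ-1)
        M⁻¹ : M * (N x * inv (D x)) ≈ 1#
        M⁻¹ = begin
          M * (N x * inv (D x))
            ≈⟨ *-congʳ (+-congʳ (*-congˡ (σ-+1 v))) ⟩
          ((v + 1#) * (σ v + 1#) + 1#) * (N x * inv (D x))             ≈⟨ solve 5 (λ x s v t i →
              ((v :+ :1) :* (t :+ :1) :+ :1) :* (x :* s :* i)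
              := (x :* v :* (s :* t) :+ x :* v :* s :+ s :* t :* x) :* i) refl x (σ x) v (σ v) (inv (D x)) ⟩
          (x * v * (σ x * σ v) + x * v * σ x + σ x * σ v * x) * inv (D x)
            ≈⟨ *-congʳ (+-cong (+-cong (*-cong xv≈1 σxσv≈1) (*-congʳ xv≈1)) (*-congʳ σxσv≈1)) ⟩
          (1# * 1# + 1# * σ x + 1# * x) * inv (D x)
            ≈⟨ *-congʳ (solve 2 (λ x s → :1 :* :1 :+ :1 :* s :+ :1 :* x := x :+ s :+ :1) refl x (σ x)) ⟩
          D x * inv (D x)                                              ≈⟨ inverseʳ (D≉0 x) ⟩
          1#                                                           ∎

      -- The denominators agree and the numerators add up to x + σ(x), which is D(x) + 1.
      g-pair : ∀ x → g x + g (x + 1#) ≈ 1# + inv (D x)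
      g-pair x = begin
        g x + g (x + 1#)
          ≈⟨ +-congˡ (*-cong (*-congˡ (σ-+1 x)) (inv-cong (trans (+-congʳ (+-congˡ (σ-+1 x)))
               (solve 2 (λ x s → x :+ :1 :+ (s :+ :1) :+ :1 := x :+ s :+ :1) refl x (σ x))))) ⟩
        (x + 1#) * σ x * inv (D x) + (x + 1# + 1#) * (σ x + 1#) * inv (D x)
          ≈⟨ solve 3 (λ x s i → (x :+ :1) :* s :* i :+ (x :+ :1 :+ :1) :* (s :+ :1) :* i
                                := (x :+ s :+ :1) :* i :+ i) refl x (σ x) (inv (D x)) ⟩
        D x * inv (D x) + inv (D x)                                          ≈⟨ +-congʳ (inverseʳ (D≉0 x)) ⟩
        1# + inv (D x)                                                       ∎

-- Necessity

module Necessity {q : ℕ} {c r : Level} {F : FiniteField q c r} (Φ : OddAutomorphism F) where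
  open Trace Φ
  open SetoidReasoning setoid

  _≈²_ : Carrier × Carrier → Carrier × Carrier → Set r
  _≈²_ = Pointwise _≈_ _≈_

  ∑²-swap : ∀ {f} → Congruent _≈²_ _≈_ f → ∑² f ≈ ∑² (f ∘ swap)
  ∑²-swap f-cong = ∑²-reindex swap f-cong swap swap

  module _ (∑≈0 : ∑ id ≈ 0#) where

    -- As `N` is a bijection, `N X` and `N Y` may be replaced by free variables a and b. For fixed a
    -- the sum a + b runs through the field, so the double sum factors through `∑ id`.
    ∑²inv·NX≈0 : ∑² (λ (X , Y) → inv (A X Y) * N X) ≈ 0#
    ∑²inv·NX≈0 = begin
      ∑² (λ (X , Y) → inv (A X Y) * N X)       ≈⟨ ∑²-reindex (λ (X , Y) → N X , N Y)
                                                    (λ (p , q) → *-cong (inv-cong (+-cong p q)) p)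
                                                    (λ (p , q) → N-cong p , N-cong q)
                                                    (λ (p , q) → N-injective p , N-injective q) ⟨
      ∑² (λ (a , b) → inv (a + b) * a)         ≈⟨ ∑²-iterated (λ (a , b) → inv (a + b) * a) ⟩
      ∑ (λ a → ∑ (λ b → inv (a + b) * a))      ≈⟨ ∑-cong inner ⟩
      ∑ (λ a → ∑ inv * a)                      ≈⟨ ∑-*ˡ (∑ inv) id ⟩
      ∑ inv * ∑ id                             ≈⟨ trans (*-congˡ ∑≈0) (zeroʳ _) ⟩
      0#                                       ∎
      where
      inner : ∀ a → ∑ (λ b → inv (a + b) * a) ≈ ∑ inv * a
      inner a = begin
        ∑ (λ b → inv (a + b) * a)      ≈⟨ ∑-cong (λ b → *-comm (inv (a + b)) a) ⟩
        ∑ (λ b → a * inv (a + b))      ≈⟨ ∑-*ˡ a (λ b → inv (a + b)) ⟩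
        a * ∑ (λ b → inv (a + b))      ≈⟨ *-congˡ (∑-reindex (a +_) inv-cong +-congˡ
                                            (λ eq → +-cancelʳ a (trans (+-comm _ a) (trans eq (+-comm a _))))) ⟨
        a * ∑ inv                      ≈⟨ *-comm a _ ⟩
        ∑ inv * a                      ∎

    ∑²inv·NY≈0 : ∑² (λ (X , Y) → inv (A X Y) * N Y) ≈ 0#
    ∑²inv·NY≈0 = begin
      ∑² (λ (X , Y) → inv (A X Y) * N Y)
        ≈⟨ ∑²-cong (λ (X , Y) → *-congʳ {N Y} (inv-cong (+-comm (N X) (N Y)))) ⟩
      ∑² (λ (X , Y) → inv (A Y X) * N Y)
        ≈⟨ ∑²-swap (λ (p , q) → *-cong (inv-cong (A-cong p q)) (N-cong p)) ⟨
      ∑² (λ (X , Y) → inv (A X Y) * N X)       ≈⟨ ∑²inv·NX≈0 ⟩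
      0#                                       ∎

    -- For nonzero `X`, replacing `Y` by X Y cancels `N X` and leaves the single sum
    -- `∑x·inv[1+Nx]≈1`; for zero `X` every term vanishes. Both values are written `X * inv X`.
    ∑²inv·YσX≈1 : ∑² (λ (X , Y) → inv (A X Y) * (Y * σ X)) ≈ 1#
    ∑²inv·YσX≈1 = begin
      ∑² (λ (X , Y) → inv (A X Y) * (Y * σ X))         ≈⟨ ∑²-iterated (λ (X , Y) → inv (A X Y) * (Y * σ X)) ⟩
      ∑ (λ X → ∑ (λ Y → inv (A X Y) * (Y * σ X)))      ≈⟨ ∑-cong (λ X → inner X (X ≟ 0#)) ⟩
      ∑ (λ X → X * inv X)                              ≈⟨ ∑x·x⁻¹≈1 ⟩
      1#                                               ∎
      where
      inner : ∀ X → Dec (X ≈ 0#) → ∑ (λ Y → inv (A X Y) * (Y * σ X)) ≈ X * inv X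
      inner X (yes X≈0) = trans
        (∑-ε (λ Y → trans (*-congˡ (trans (*-congˡ (trans (σ-cong X≈0) σ-0)) (zeroʳ Y))) (zeroʳ (inv (A X Y)))))
        (sym (trans (*-congʳ X≈0) (zeroˡ _)))
      inner X (no X≉0) = begin
        ∑ (λ Y → inv (A X Y) * (Y * σ X))                ≈⟨ ∑-reindex (X *_)
            (λ p → *-cong (inv-cong (A-cong refl p)) (*-congʳ p)) *-congˡ (*-cancelˡ-nonZero X≉0) ⟩
        ∑ (λ Y → inv (A X (X * Y)) * (X * Y * σ X))      ≈⟨ ∑-cong scaled ⟩
        ∑ (λ Y → Y * inv (N Y + 1#))                     ≈⟨ ∑x·inv[1+Nx]≈1 ∑≈0 ⟩
        1#                                               ≈⟨ inverseʳ X≉0 ⟨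
        X * inv X                                        ∎
        where
        NX≉0 : N X ≉ 0#
        NX≉0 = X≉0 ∘ N≈0⇒≈0
        scaled : ∀ Y → inv (A X (X * Y)) * (X * Y * σ X) ≈ Y * inv (N Y + 1#)
        scaled Y = begin
          inv (A X (X * Y)) * (X * Y * σ X)                  ≈⟨ *-congʳ (inv-cong (+-congˡ (N-* X Y))) ⟩
          inv (N X + N X * N Y) * (X * Y * σ X)
            ≈⟨ *-congʳ (inv-cong (solve 2 (λ a b → a :+ a :* b := a :* (b :+ :1)) refl (N X) (N Y))) ⟩
          inv (N X * (N Y + 1#)) * (X * Y * σ X)             ≈⟨ *-congʳ (inv-* (N X) (N Y + 1#)) ⟩
          inv (N X) * inv (N Y + 1#) * (X * Y * σ X)
            ≈⟨ solve 5 (λ i j x s y → i :* j :* (x :* y :* s) := x :* s :* i :* (y :* j)) refl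
                                                                 (inv (N X)) (inv (N Y + 1#)) X (σ X) Y ⟩
          N X * inv (N X) * (Y * inv (N Y + 1#))             ≈⟨ *-congʳ (inverseʳ NX≉0) ⟩
          1# * (Y * inv (N Y + 1#))                          ≈⟨ *-identityˡ _ ⟩
          Y * inv (N Y + 1#)                                 ∎

    ∑²inv·XσY≈1 : ∑² (λ (X , Y) → inv (A X Y) * (X * σ Y)) ≈ 1#
    ∑²inv·XσY≈1 = begin
      ∑² (λ (X , Y) → inv (A X Y) * (X * σ Y))
        ≈⟨ ∑²-cong (λ (X , Y) → *-congʳ {X * σ Y} (inv-cong (+-comm (N X) (N Y)))) ⟩
      ∑² (λ (X , Y) → inv (A Y X) * (X * σ Y))
        ≈⟨ ∑²-swap (λ (p , q) → *-cong (inv-cong (A-cong p q)) (*-cong q (σ-cong p))) ⟨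
      ∑² (λ (X , Y) → inv (A X Y) * (Y * σ X))   ≈⟨ ∑²inv·YσX≈1 ⟩
      1#                                         ∎

    ∑²inv·form : ∀ e f g h → ∑² (λ (X , Y) → inv (A X Y) * (e * N X + f * (X * σ Y) + g * (Y * σ X) + h * N Y)) ≈ f + g
    ∑²inv·form e f g h = begin
      ∑² (λ (X , Y) → inv (A X Y) * (e * N X + f * (X * σ Y) + g * (Y * σ X) + h * N Y))
        ≈⟨ ∑²-cong (λ (X , Y) → distribute (inv (A X Y)) (N X) (X * σ Y) (Y * σ X) (N Y)) ⟩
      ∑² (λ p → e * t₁ p + f * t₂ p + g * t₃ p + h * t₄ p)
        ≈⟨ trans (∑²-∙ (λ p → e * t₁ p + f * t₂ p + g * t₃ p) (λ p → h * t₄ p))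
             (+-congʳ (trans (∑²-∙ (λ p → e * t₁ p + f * t₂ p) (λ p → g * t₃ p))
               (+-congʳ (∑²-∙ (λ p → e * t₁ p) (λ p → f * t₂ p))))) ⟩
      ∑² (λ p → e * t₁ p) + ∑² (λ p → f * t₂ p) + ∑² (λ p → g * t₃ p) + ∑² (λ p → h * t₄ p)
        ≈⟨ +-cong (+-cong (+-cong (scale e t₁ ∑²inv·NX≈0) (scale f t₂ ∑²inv·XσY≈1)) (scale g t₃ ∑²inv·YσX≈1))
             (scale h t₄ ∑²inv·NY≈0) ⟩
      e * 0# + f * 1# + g * 1# + h * 0#
        ≈⟨ solve 4 (λ e f g h → e :* :0 :+ f :* :1 :+ g :* :1 :+ h :* :0 := f :+ g) refl e f g h ⟩
      f + g ∎
      where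
      t₁ t₂ t₃ t₄ : Carrier × Carrier → Carrier
      t₁ (X , Y) = inv (A X Y) * N X
      t₂ (X , Y) = inv (A X Y) * (X * σ Y)
      t₃ (X , Y) = inv (A X Y) * (Y * σ X)
      t₄ (X , Y) = inv (A X Y) * N Y
      distribute : ∀ i a b c d → i * (e * a + f * b + g * c + h * d) ≈
                                 e * (i * a) + f * (i * b) + g * (i * c) + h * (i * d)
      distribute i a b c d = trans
        (solve 5 (λ i a b c d → i :* (a :+ b :+ c :+ d) := i :* a :+ i :* b :+ i :* c :+ i :* d) refl
           i (e * a) (f * b) (g * c) (h * d))
        (+-cong (+-cong (+-cong (exchange i e a) (exchange i f b)) (exchange i g c)) (exchange i h d))
        where
        exchange : ∀ x y z → x * (y * z) ≈ y * (x * z)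
        exchange = solve 3 (λ x y z → x :* (y :* z) := y :* (x :* z)) refl
      scale : ∀ a t {s} → ∑² t ≈ s → ∑² (λ p → a * t p) ≈ a * s
      scale a t eq = trans (∑²-*ˡ a t) (*-congˡ eq)

    -- Here δ stands for (1 + α²)/β, the coefficient of `Y` in y + αx = αX + δY.
    module _ {α β : Carrier} (α≉0 : α ≉ 0#) (β≉0 : β ≉ 0#)
      (injective : ∀ {x y x′ y′} → Rσ α β x y ≈ Rσ α β x′ y′ → Rσ α β y x ≈ Rσ α β y′ x′ → x ≈ x′ × y ≈ y′)
      {δ : Carrier} (βδ : β * δ ≈ 1# + α * α) where

      -- Rσ α β y x in the coordinates X = x + α y, Y = β y
      swapped : Carrier → Carrier → Carrier
      swapped X Y = N (α * X + δ * Y) + N (β * X + α * Y)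

      swapped-cong : ∀ {X X′ Y Y′} → X ≈ X′ → Y ≈ Y′ → swapped X Y ≈ swapped X′ Y′
      swapped-cong p q = +-cong (N-cong (+-cong (*-congˡ p) (*-congˡ q))) (N-cong (+-cong (*-congˡ p) (*-congˡ q)))

      swapped-coordinates : ∀ x y → swapped (x + α * y) (β * y) ≈ Rσ α β y x
      swapped-coordinates x y = +-cong
        (N-cong (begin
          α * (x + α * y) + δ * (β * y)
            ≈⟨ solve 5 (λ a b d x y → a :* (x :+ a :* y) :+ d :* (b :* y) := a :* (x :+ a :* y) :+ b :* d :* y) refl α β δ x y ⟩
          α * (x + α * y) + β * δ * y                ≈⟨ +-congˡ (*-congʳ βδ) ⟩
          α * (x + α * y) + (1# + α * α) * y
            ≈⟨ solve 3 (λ a x y → a :* (x :+ a :* y) :+ (:1 :+ a :* a) :* y := y :+ a :* x) refl α x y ⟩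
          y + α * x                                  ∎))
        (N-cong (solve 4 (λ a b x y → b :* (x :+ a :* y) :+ a :* (b :* y) := b :* x) refl α β x y))

      swapped-expand : ∀ X Y → swapped X Y ≈
        A α β * N X + (α * σ δ + β * σ α) * (X * σ Y) + (δ * σ α + α * σ β) * (Y * σ X) + (N δ + N α) * N Y
      swapped-expand X Y = trans
        (+-cong (*-congˡ (σ-linear α δ X Y)) (*-congˡ (σ-linear β α X Y)))
        (trans (+-cong (product α δ X Y (σ α) (σ δ) (σ X) (σ Y)) (product β α X Y (σ β) (σ α) (σ X) (σ Y)))
          (solve 12 (λ a b c d e f g h x y z w →
             a :* x :+ b :* y :+ c :* z :+ d :* w :+ (e :* x :+ f :* y :+ g :* z :+ h :* w)
             := (a :+ e) :* x :+ (b :+ f) :* y :+ (c :+ g) :* z :+ (d :+ h) :* w) refl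
             (α * σ α) (α * σ δ) (δ * σ α) (δ * σ δ) (β * σ β) (β * σ α) (α * σ β) (α * σ α)
             (X * σ X) (X * σ Y) (Y * σ X) (Y * σ Y)))
        where
        product : ∀ a d X Y sa sd sX sY → (a * X + d * Y) * (sa * sX + sd * sY) ≈
                  a * sa * (X * sX) + a * sd * (X * sY) + d * sa * (Y * sX) + d * sd * (Y * sY)
        product = solve 8 (λ a d X Y sa sd sX sY → (a :* X :+ d :* Y) :* (sa :* sX :+ sd :* sY)
          := a :* sa :* (X :* sX) :+ a :* sd :* (X :* sY) :+ d :* sa :* (Y :* sX) :+ d :* sd :* (Y :* sY)) refl

      -- The sum of s⁻¹ t over all pairs (s , t) vanishes, and may be
      -- computed by substituting ψ (x , y) for (s , t).
      ∑²inv·swapped≈0 : ∑² (λ (X , Y) → inv (A X Y) * swapped X Y) ≈ 0#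
      ∑²inv·swapped≈0 = begin
        ∑² (λ (X , Y) → inv (A X Y) * swapped X Y)
          ≈⟨ ∑²-reindex (λ (x , y) → x + α * y , β * y)
               (λ (p , q) → *-cong (inv-cong (A-cong p q)) (swapped-cong p q))
               (λ (p , q) → +-cong p (*-congˡ q) , *-congˡ q)
               (λ {p} {p′} (e , e′) → let y≈y′ = *-cancelˡ-nonZero β≉0 e′ in
                  +-cancelʳ (α * proj₂ p) (trans e (+-congˡ (*-congˡ (sym y≈y′)))) , y≈y′) ⟩
        ∑² (λ (x , y) → inv (Rσ α β x y) * swapped (x + α * y) (β * y))
          ≈⟨ ∑²-cong (λ (x , y) → *-congˡ {inv (Rσ α β x y)} (swapped-coordinates x y)) ⟩
        ∑² (λ (x , y) → inv (Rσ α β x y) * Rσ α β y x)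
          ≈⟨ ∑²-reindex (λ (x , y) → Rσ α β x y , Rσ α β y x)
               (λ (p , q) → *-cong (inv-cong p) q)
               (λ (p , q) → Rσ-cong α β p q , Rσ-cong α β q p)
               (λ (p , q) → injective p q) ⟨
        ∑² (λ (s , t) → inv s * t)            ≈⟨ ∑²-iterated (λ (s , t) → inv s * t) ⟩
        ∑ (λ s → ∑ (λ t → inv s * t))
          ≈⟨ ∑-ε (λ s → trans (∑-*ˡ (inv s) id) (trans (*-congˡ ∑≈0) (zeroʳ (inv s)))) ⟩
        0#                                    ∎

      -- These are κ = (1 + α² + β²)/β and ρ = (1 + α² + β²)/(αβ), so the condition to be proved
      -- reads ρ = 1.
      κ ρ : Carrier
      κ = δ + β
      ρ = κ * inv α

      αρ≈κ : α * ρ ≈ κ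
      αρ≈κ = begin
        α * (κ * inv α)    ≈⟨ solve 3 (λ a k i → a :* (k :* i) := a :* i :* k) refl α κ (inv α) ⟩
        α * inv α * κ      ≈⟨ *-congʳ (inverseʳ α≉0) ⟩
        1# * κ             ≈⟨ *-identityˡ κ ⟩
        κ                  ∎

      -- The sum of `inv (A X Y) * swapped X Y` is the sum of the two sides by expansion and zero by
      -- injectivity of the map.
      symmetric : α * σ δ + β * σ α ≈ δ * σ α + α * σ β
      symmetric = x+y≈0⇒x≈y (begin
        α * σ δ + β * σ α + (δ * σ α + α * σ β)
          ≈⟨ ∑²inv·form (A α β) (α * σ δ + β * σ α) (δ * σ α + α * σ β) (N δ + N α) ⟨
        ∑² (λ (X , Y) → inv (A X Y) * (A α β * N X + (α * σ δ + β * σ α) * (X * σ Y)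
                                       + (δ * σ α + α * σ β) * (Y * σ X) + (N δ + N α) * N Y))
                                                      ≈⟨ ∑²-cong (λ (X , Y) → *-congˡ {inv (A X Y)} (swapped-expand X Y)) ⟨
        ∑² (λ (X , Y) → inv (A X Y) * swapped X Y)    ≈⟨ ∑²inv·swapped≈0 ⟩
        0#                                            ∎)

      -- The relation `symmetric` rearranges to α σ(κ) = κ σ(α), the invariance of κ/α.
      σρ≈ρ : σ ρ ≈ ρ
      σρ≈ρ = *-cancelˡ-nonZero (α≉0 ∘ N≈0⇒≈0) (begin
        α * σ α * σ ρ            ≈⟨ trans (*-assoc _ _ _) (*-congˡ (sym (σ-* α ρ))) ⟩
        α * σ (α * ρ)            ≈⟨ *-congˡ (trans (σ-cong αρ≈κ) (σ-+ δ β)) ⟩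
        α * (σ δ + σ β)          ≈⟨ x+y≈0⇒x≈y (begin
          α * (σ δ + σ β) + σ α * (δ + β)
            ≈⟨ solve 6 (λ a b d sa sb sd → a :* (sd :+ sb) :+ sa :* (d :+ b)
                                                    := a :* sd :+ b :* sa :+ (d :* sa :+ a :* sb)) refl α β δ (σ α) (σ β) (σ δ) ⟩
          α * σ δ + β * σ α + (δ * σ α + α * σ β)  ≈⟨ trans (+-congʳ symmetric) (x+x≈0 _) ⟩
          0#                                       ∎) ⟩
        σ α * κ                  ≈⟨ *-congˡ αρ≈κ ⟨
        σ α * (α * ρ)            ≈⟨ solve 3 (λ s a r → s :* (a :* r) := a :* s :* r) refl (σ α) α ρ ⟩
        α * σ α * ρ              ∎)

      βκ : β * κ ≈ 1# + α * α + β * β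
      βκ = trans (distribˡ _ _ _) (+-congʳ βδ)

      -- If κ vanished, then so would (1 + α + β)², giving 1 + α = β. Both components at (1, 1)
      -- would be N β + N β = 0, as at (0, 0).
      κ≉0 : κ ≉ 0#
      κ≉0 κ≈0 = 0≉1 (sym (proj₁ (injective R11≈R00 R11≈R00)))
        where
        square≈0 : (1# + α + β) * (1# + α + β) ≈ 0#
        square≈0 = begin
          (1# + α + β) * (1# + α + β)
            ≈⟨ solve 2 (λ a b → (:1 :+ a :+ b) :* (:1 :+ a :+ b) := :1 :+ a :* a :+ b :* b) refl α β ⟩
          1# + α * α + β * β              ≈⟨ βκ ⟨
          β * κ                           ≈⟨ trans (*-congˡ κ≈0) (zeroʳ β) ⟩
          0#                              ∎
        1+α≈β : 1# + α ≈ β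
        1+α≈β with (1# + α + β) ≟ 0#
        ... | yes eq = x+y≈0⇒x≈y eq
        ... | no neq = contradiction square≈0 (*-nonZero neq neq)
        R11≈R00 : Rσ α β 1# 1# ≈ Rσ α β 0# 0#
        R11≈R00 = begin
          N (1# + α * 1#) + N (β * 1#)
            ≈⟨ +-cong (N-cong (trans (+-congˡ (*-identityʳ α)) 1+α≈β)) (N-cong (*-identityʳ β)) ⟩
          N β + N β                         ≈⟨ x+x≈0 _ ⟩
          0#                                ≈⟨ x+x≈0 _ ⟨
          N 0# + N 0#
            ≈⟨ +-cong (N-cong (trans (+-identityˡ _) (zeroʳ α))) (N-cong (zeroʳ β)) ⟨
          Rσ α β 0# 0#                      ∎

      necessary : α * α + α * β + β * β ≈ 1#
      necessary = [ (λ ρ≈0 → contradiction (κ≈α* ρ≈0 (zeroʳ α)) κ≉0)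
                  , (λ ρ≈1 → condition (κ≈α* ρ≈1 (*-identityʳ α)))
                  ]′ (fixed σρ≈ρ)
        where
        κ≈α* : ∀ {x y} → ρ ≈ x → α * x ≈ y → κ ≈ y
        κ≈α* ρ≈x αx≈y = trans (sym αρ≈κ) (trans (*-congˡ ρ≈x) αx≈y)
        -- Multiplying κ = α by β turns it into 1 + α² + β² = αβ.
        condition : κ ≈ α → α * α + α * β + β * β ≈ 1#
        condition κ≈α = x+y≈0⇒x≈y (begin
          α * α + α * β + β * β + 1#
            ≈⟨ solve 2 (λ a b → a :* a :+ a :* b :+ b :* b :+ :1 := b :* a :+ (:1 :+ a :* a :+ b :* b)) refl α β ⟩
          β * α + (1# + α * α + β * β)             ≈⟨ +-congˡ βκ ⟨
          β * α + β * κ                            ≈⟨ +-congˡ (*-congˡ κ≈α) ⟩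
          β * α + β * α                            ≈⟨ x+x≈0 _ ⟩
          0#                                       ∎)

-- The Frobenius automorphism

least : ∀ {p} {P : ℕ → Set p} → (∀ n → Dec (P n)) → ∀ n → P n → ∃ λ m → P m × (∀ {i} → i < m → ¬ P i)
least {p} {P} P? = <-rec (λ n → P n → Least) λ n smaller Pn → step n smaller Pn (ℕ.anyUpTo? P? n)
  where
  Least : Set p
  Least = ∃ λ m → P m × (∀ {i} → i < m → ¬ P i)
  step : ∀ n → (∀ {i} → i < n → P i → Least) → P n → Dec (∃ λ i → i < n × P i) → Least
  step n smaller Pn (yes (i , i<n , Pi)) = smaller i<n Pi
  step n smaller Pn (no none) = n , Pn , λ i<n Pi → none (_ , i<n , Pi)

2∤⇒odd : ∀ {k} → 2 ∤ k → ∃ λ h → k ≡ suc (h ℕ.+ h)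
2∤⇒odd {k} 2∤k with parity k
... | h , inj₂ k≡1+2h = h , k≡1+2h
... | h , inj₁ ≡.refl = contradiction (divides h (≡.sym (≡.trans (ℕ.*-comm h 2) (≡.cong (h ℕ.+_) (ℕ.+-identityʳ h))))) 2∤k

module BinaryField {k : ℕ} {c r : Level} (F : FiniteField (2 ℕ.^ k) c r) where
  open FieldTheory F
  open SetoidReasoning setoid
  open Mult semiring using (×1-homo-*) renaming (_×_ to _·_)

  -- Otherwise every power of 2 would be nonzero in the field, whereas `order·1≈0` kills the power
  -- 2ᵏ.
  1+1≈0 : 1# + 1# ≈ 0#
  1+1≈0 with (1# + 1#) ≟ 0#
  ... | yes eq = eq
  ... | no neq = contradiction order·1≈0 (power≉0 k)
    where
    power≉0 : ∀ n → (2 ℕ.^ n) · 1# ≉ 0#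
    power≉0 zero eq = 0≉1 (trans (sym eq) (+-identityʳ 1#))
    power≉0 (suc n) eq = *-nonZero (neq ∘ trans (+-congˡ (sym (+-identityʳ 1#)))) (power≉0 n)
      (trans (sym (×1-homo-* 2 (2 ℕ.^ n))) eq)

  open CharacteristicTwo 1+1≈0

  frobenius : ℕ → Op₁
  frobenius n x = x ^ (2 ℕ.^ n)

  square : ∀ x → x ^ 2 ≈ x * x
  square x = *-congˡ (*-identityʳ x)

  frobenius-suc : ∀ n x → frobenius (suc n) x ≈ frobenius n (x * x)
  frobenius-suc n x = trans (sym (^-assocʳ x 2 (2 ℕ.^ n))) (^-congˡ (2 ℕ.^ n) (square x))

  frobenius-+ : ∀ n x y → frobenius n (x + y) ≈ frobenius n x + frobenius n y
  frobenius-+ zero    x y = trans (*-identityʳ _) (sym (+-cong (*-identityʳ x) (*-identityʳ y)))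
  frobenius-+ (suc n) x y = begin
    frobenius (suc n) (x + y)                        ≈⟨ frobenius-suc n (x + y) ⟩
    frobenius n ((x + y) * (x + y))                  ≈⟨ ^-congˡ (2 ℕ.^ n) (square-additive x y) ⟩
    frobenius n (x * x + y * y)                      ≈⟨ frobenius-+ n (x * x) (y * y) ⟩
    frobenius n (x * x) + frobenius n (y * y)        ≈⟨ +-cong (frobenius-suc n x) (frobenius-suc n y) ⟨
    frobenius (suc n) x + frobenius (suc n) y        ∎

  frobenius-∘ : ∀ m n x → frobenius m (frobenius n x) ≈ frobenius (m ℕ.+ n) x
  frobenius-∘ m n x = trans (^-assocʳ x (2 ℕ.^ n) (2 ℕ.^ m)) (^-congʳ x exponents)
    where
    exponents : 2 ℕ.^ n ℕ.* 2 ℕ.^ m ≡ 2 ℕ.^ (m ℕ.+ n)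
    exponents = ≡.trans (ℕ.*-comm (2 ℕ.^ n) (2 ℕ.^ m)) (≡.sym (ℕ.^-distribˡ-+-* 2 m n))

  frobenius-1 : ∀ n → frobenius n 1# ≈ 1#
  frobenius-1 n = 1^ (2 ℕ.^ n)
    where
    1^ : ∀ m → 1# ^ m ≈ 1#
    1^ zero    = refl
    1^ (suc m) = trans (*-identityˡ _) (1^ m)

  frobenius-multiple : ∀ {m x} n → frobenius m x ≈ x → frobenius (n ℕ.* m) x ≈ x
  frobenius-multiple {m} {x} zero    eq = *-identityʳ x
  frobenius-multiple {m} {x} (suc n) eq = begin
    frobenius (m ℕ.+ n ℕ.* m) x            ≈⟨ frobenius-∘ m (n ℕ.* m) x ⟨
    frobenius m (frobenius (n ℕ.* m) x)    ≈⟨ ^-congˡ (2 ℕ.^ m) (frobenius-multiple n eq) ⟩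
    frobenius m x                          ≈⟨ eq ⟩
    x                                      ∎

  fold-frobenius : ∀ m n x → fold x (frobenius m) n ≈ frobenius (n ℕ.* m) x
  fold-frobenius m zero    x = sym (*-identityʳ x)
  fold-frobenius m (suc n) x = trans (^-congˡ (2 ℕ.^ m) (fold-frobenius m n x)) (frobenius-∘ m (n ℕ.* m) x)

  idempotent⇒0⊎1 : ∀ {x} → x * x ≈ x → x ≈ 0# ⊎ x ≈ 1#
  idempotent⇒0⊎1 {x} xx≈x with x ≟ 0#
  ... | yes x≈0 = inj₁ x≈0
  ... | no x≉0 = inj₂ (*-cancelˡ-nonZero x≉0 (trans xx≈x (sym (*-identityʳ x))))

  -- `frobenius k` fixes every element and `frobenius ℓ` fixes `x`. By Bézout some multiples of k
  -- and ℓ differ by 1, so squaring fixes `x` as well.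
  frobenius-fixed : ∀ {ℓ} → Coprime k ℓ → ∀ {x} → frobenius ℓ x ≈ x → x ≈ 0# ⊎ x ≈ 1#
  frobenius-fixed {ℓ} coprime {x} eq = idempotent⇒0⊎1 (trans (sym (square x)) (fixed-by-1 (coprime-Bézout coprime)))
    where
    combine-fixed : ∀ a b → frobenius a x ≈ x → frobenius b x ≈ x → 1 ℕ.+ b ≡ a → frobenius 1 x ≈ x
    combine-fixed a b a-fixed b-fixed ≡.refl = begin
      frobenius 1 x                   ≈⟨ ^-congˡ 2 b-fixed ⟨
      frobenius 1 (frobenius b x)     ≈⟨ frobenius-∘ 1 b x ⟩
      frobenius (1 ℕ.+ b) x           ≈⟨ a-fixed ⟩
      x                               ∎
    fixed-by-1 : Bézout.Identity 1 k ℓ → frobenius 1 x ≈ x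
    fixed-by-1 (Bézout.Identity.+- a b e) =
      combine-fixed (a ℕ.* k) (b ℕ.* ℓ) (frobenius-multiple a (x^order≈x x)) (frobenius-multiple b eq) e
    fixed-by-1 (Bézout.Identity.-+ a b e) =
      combine-fixed (b ℕ.* ℓ) (a ℕ.* k) (frobenius-multiple b eq) (frobenius-multiple a (x^order≈x x)) e

  module _ {ℓ : ℕ} (coprime : Coprime k ℓ) (2∤k : 2 ∤ k) where

    private
      σ : Op₁
      σ = frobenius ℓ

      HasOrder : ℕ → Set _
      HasOrder i = ∀ x → fold x σ (suc (i ℕ.+ i)) ≈ x

      fold-cong : ∀ n → Congruent _≈_ _≈_ (λ x → fold x σ n)
      fold-cong zero    x≈y = x≈y
      fold-cong (suc n) x≈y = ^-congˡ (2 ℕ.^ ℓ) (fold-cong n x≈y)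

      hasOrder? : ∀ i → Dec (HasOrder i)
      hasOrder? i = all? (λ x≈y eq → trans (fold-cong (suc (i ℕ.+ i)) (sym x≈y)) (trans eq x≈y))
                         (λ x → fold x σ (suc (i ℕ.+ i)) ≟ x)

      -- The k-th power of σ raises to the power 2^(kℓ), which is an iterate of the identity map
      -- `frobenius k`.
      hasOrder-k : ∃ HasOrder
      hasOrder-k = proj₁ odd , λ x → begin
        fold x σ (suc (h ℕ.+ h))         ≡⟨ ≡.cong (fold x σ) (proj₂ odd) ⟨
        fold x σ k                       ≈⟨ fold-frobenius ℓ k x ⟩
        frobenius (k ℕ.* ℓ) x            ≈⟨ ^-congʳ x (≡.cong (2 ℕ.^_) (ℕ.*-comm k ℓ)) ⟩
        frobenius (ℓ ℕ.* k) x            ≈⟨ frobenius-multiple ℓ (x^order≈x x) ⟩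
        x                                ∎
        where
        odd = 2∤⇒odd 2∤k
        h = proj₁ odd

      leastOrder : ∃ λ m → HasOrder m × (∀ {i} → i < m → ¬ HasOrder i)
      leastOrder = least hasOrder? (proj₁ hasOrder-k) (proj₂ hasOrder-k)

    frobeniusAutomorphism : OddAutomorphism F
    frobeniusAutomorphism = record
      { 1+1≈0     = 1+1≈0
      ; σ         = σ
      ; σ-cong    = ^-congˡ (2 ℕ.^ ℓ)
      ; σ-+       = frobenius-+ ℓ
      ; σ-*       = λ x y → ^-distrib-* x y (2 ℕ.^ ℓ)
      ; σ-1       = frobenius-1 ℓ
      ; fixed     = frobenius-fixed coprime
      ; half      = proj₁ leastOrder
      ; odd-order = proj₁ (proj₂ leastOrder)
      ; minimal   = proj₂ (proj₂ leastOrder)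
      }

    open Norm frobeniusAutomorphism using (Rσ; Rσ-cong; N; sufficient)
    open Necessity frobeniusAutomorphism using (necessary)

    -- Multiplication by `a` permutes the field, so (a + 1) annihilates the sum, and a + 1 is
    -- nonzero.
    ∑≈0 : ∀ {a} → a ≉ 0# → a ≉ 1# → ∑ id ≈ 0#
    ∑≈0 {a} a≉0 a≉1 = *≈0⇒≈0 (a≉1 ∘ x+y≈0⇒x≈y) (begin
      (a + 1#) * ∑ id           ≈⟨ distribʳ (∑ id) a 1# ⟩
      a * ∑ id + 1# * ∑ id      ≈⟨ +-cong (sym (∑-*ˡ a id)) (*-identityˡ _) ⟩
      ∑ (a *_) + ∑ id           ≈⟨ +-congʳ (∑-reindex (a *_) id *-congˡ (*-cancelˡ-nonZero a≉0)) ⟨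
      ∑ id + ∑ id               ≈⟨ x+x≈0 _ ⟩
      0#                        ∎)

    x^[Q+1]≈N : ∀ x → x ^ (2 ℕ.^ ℓ ℕ.+ 1) ≈ N x
    x^[Q+1]≈N x = trans (^-homo-* x (2 ℕ.^ ℓ) 1) (trans (*-congˡ (*-identityʳ x)) (*-comm _ x))

    module _ {α β : Carrier} (α≉0 : α ≉ 0#) (β≉0 : β ≉ 0#) where

      R≈Rσ : ∀ x y → R F (2 ℕ.^ ℓ) α β x y ≈ Rσ α β x y
      R≈Rσ x y = +-cong (x^[Q+1]≈N (x + α * y)) (x^[Q+1]≈N (β * y))

      R-cong : ∀ {x x′ y y′} → x ≈ x′ → y ≈ y′ → R F (2 ℕ.^ ℓ) α β x y ≈ R F (2 ℕ.^ ℓ) α β x′ y′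
      R-cong p q = trans (R≈Rσ _ _) (trans (Rσ-cong α β p q) (sym (R≈Rσ _ _)))

      condition⇔ : α ^ 2 + α * β + β ^ 2 ≈ α * α + α * β + β * β
      condition⇔ = +-cong (+-congʳ (square α)) (square β)

      permutation⇒condition : IsPermutation² F (ψ F (2 ℕ.^ ℓ) α β) → α ^ 2 + α * β + β ^ 2 ≈ 1#
      permutation⇒condition (injective , _) = trans condition⇔ (by-cases (α ≟ 1#) (β ≟ 1#))
        where
        sum-vanishes : ∑ id ≈ 0# → α * α + α * β + β * β ≈ 1#
        sum-vanishes ∑id≈0 = necessary ∑id≈0 α≉0 β≉0
          (λ p q → injective (trans (R≈Rσ _ _) (trans p (sym (R≈Rσ _ _))) , trans (R≈Rσ _ _) (trans q (sym (R≈Rσ _ _)))))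
          -- This equation fixes the implicit `δ` as `(1# + α * α) * inv β`.
          (trans (solve 3 (λ b i a → b :* (a :* i) := b :* i :* a) refl β (inv β) (1# + α * α))
                 (trans (*-congʳ (inverseʳ β≉0)) (*-identityˡ _)))
        by-cases : Dec (α ≈ 1#) → Dec (β ≈ 1#) → α * α + α * β + β * β ≈ 1#
        -- With α = β = 1 the field may be 𝔽₂, where `∑ id` is nonzero, but the condition holds
        -- outright. Otherwise α or β is an element other than 0 and 1, as `∑≈0` requires.
        by-cases (yes α≈1) (yes β≈1) = trans
          (+-cong (+-cong (*-cong α≈1 α≈1) (*-cong α≈1 β≈1)) (*-cong β≈1 β≈1))
          (solve 0 (:1 :* :1 :+ :1 :* :1 :+ :1 :* :1 := :1) refl)
        by-cases (no α≉1) _ = sum-vanishes (∑≈0 α≉0 α≉1)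
        by-cases (yes _) (no β≉1) = sum-vanishes (∑≈0 β≉0 β≉1)

      condition⇒permutation : α ^ 2 + α * β + β ^ 2 ≈ 1# → IsPermutation² F (ψ F (2 ℕ.^ ℓ) α β)
      condition⇒permutation condition = injective , surjective
        where
        injective : Injective (Pointwise _≈_ _≈_) (Pointwise _≈_ _≈_) (ψ F (2 ℕ.^ ℓ) α β)
        injective (p , q) = sufficient α β α≉0 β≉0 (trans (sym condition⇔) condition)
          (trans (sym (R≈Rσ _ _)) (trans p (R≈Rσ _ _))) (trans (sym (R≈Rσ _ _)) (trans q (R≈Rσ _ _)))
        surjective : ∀ p → ∃ λ p′ → ∀ {z} → Pointwise _≈_ _≈_ z p′ → Pointwise _≈_ _≈_ (ψ F (2 ℕ.^ ℓ) α β z) p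
        surjective = Finite.injective⇒surjective (×-setoid setoid setoid) enum²
          (λ (p , q) → R-cong p q , R-cong q p) injective

corollary9p5 : ∀ {c r : Level} (k ℓ : ℕ) → 0 < k → 0 < ℓ → Coprime k ℓ → 2 ∤ k →
    (F : FiniteField (2 ℕ.^ k) c r) → let open FiniteField F in
    (α β : Carrier) → α ≉ 0# → β ≉ 0# →
    IsPermutation² F (ψ F (2 ℕ.^ ℓ) α β) ⇔ (α ^ 2 + α * β + β ^ 2 ≈ 1#)
corollary9p5 k ℓ _ _ coprime 2∤k F α β α≉0 β≉0 = mk⇔
  (permutation⇒condition coprime 2∤k α≉0 β≉0) (condition⇒permutation coprime 2∤k α≉0 β≉0)
  where open BinaryField {k} F
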